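{- Let $n\ge 0$ be an integer and $q$ a prime power, and let $B_n(q)$ be the poset of all linear subspaces of $\mathbb{F}_q^n$ ordered by inclusion. In the ruler game on $B_n(q)$, the Grundy value of a subspace $W\in B_n(q)$ depends only on $d=\dim W$; it equals the Grundy value of $\mathbb{F}_q^d$ in the ruler game on $B_d(q)$, denoted $g_q(d)$. Moreover: (i) if $q$ is even, then $g_q(d)=h(d+1)=2^{v_2(d+1)}$, where $v_2(x)$ is the exponent of the largest power of $2$ dividing $x$; (ii) if $q$ is odd, then $g_q(d)=(d \bmod 3)+1$, where $d\bmod 3\in\{0,1,2\}$ is the remainder of $d$ upon division by $3$.
   Context: Coin-turning games: let $X$ be a finite poset and $\mathcal{T}$ a family of nonempty subsets of $X$, each having a maximum element. In the game $\mathcal{G}(X,\mathcal{T})$ a position is a subset $H\subseteq X$ (the heads-up coins); a move from $H$ chooses $T\in\mathcal{T}$ with $\max T\in H$ and replaces $H$ by the symmetric difference $H\,\triangle\,T$; a player unable to move loses (normal play). The Grundy value $g(x)$ of $x\in X$ is the Sprague–Grundy value of the position $\{x\}$; equivalently $g(x)=\operatorname{mex}\{\bigoplus_{t\in T\setminus\{x\}}g(t) : T\in\mathcal{T},\ \max T=x\}$, where $\oplus$ is nim-sum (bitwise XOR) and $\operatorname{mex}(S)$ is the least nonnegative integer not in $S$. The ruler on $X$ is the game $\mathcal{G}(X,\mathcal{I})$ where $\mathcal{I}$ is the set of all closed intervals $[a,b]=\{t\in X: a\le t\le b\}$ with $a\le b$ in $X$. -}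

module Defs where

open import Data.Nat using (ℕ; zero; suc; _≡ᵇ_) renaming (_+_ to _+ℕ_; _*_ to _*ℕ_)
open import Data.Nat.DivMod using (_/_; _%_)
open import Data.Bool using (Bool; true; false; _∧_; _∨_; not; if_then_else_)
open import Data.List using (List; []; _∷_; map; filterᵇ; length; concatMap; foldr)
open import Data.List.Membership.Propositional using (_∈_)
open import Data.List.Relation.Unary.Unique.Propositional using (Unique)
open import Data.Vec using (Vec; []; _∷_; zipWith; replicate)
open import Data.Product using (Σ; _×_; _,_)
open import Relation.Binary.PropositionalEquality using (_≡_; _≢_)
open import Relation.Binary.Definitions using (DecidableEquality)
open import Relation.Nullary.Decidable using (⌊_⌋; does)
open import Relation.Unary using (Pred)
open import Algebra.Structures using (IsCommutativeRing)
open import Level using (0ℓ)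

-- bitwise XOR, computed with fuel; fuel m + n is always enough
xorF : ℕ → ℕ → ℕ → ℕ
xorF zero    m n = 0
xorF (suc k) m n =
  (if (m % 2) ≡ᵇ (n % 2) then 0 else 1) +ℕ 2 *ℕ xorF k (m / 2) (n / 2)

_⊕_ : ℕ → ℕ → ℕ
m ⊕ n = xorF (m +ℕ n) m n

nimSum : List ℕ → ℕ
nimSum = foldr _⊕_ 0

elemℕ : ℕ → List ℕ → Bool
elemℕ i []       = false
elemℕ i (j ∷ js) = (i ≡ᵇ j) ∨ elemℕ i js

mexAux : ℕ → ℕ → List ℕ → ℕ
mexAux zero    i l = i
mexAux (suc k) i l = if elemℕ i l then mexAux k (suc i) l else i

mex : List ℕ → ℕ
mex l = mexAux (length l) 0 l

-- Grundy value in the ruler game on a finite poset given by a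
-- (duplicate-free, complete) list of its elements and a Boolean order.
-- g(x) = mex { ⊕_{t ∈ [a,x], t ≠ x} g(t) : a ≤ x }   (recursion with fuel)
rulerGrundyF : {A : Set} → List A → (A → A → Bool) → ℕ → A → ℕ
rulerGrundyF els le zero    x = 0
rulerGrundyF els le (suc k) x =
  mex (map (λ a → nimSum (map (rulerGrundyF els le k)
                             (filterᵇ (λ t → le a t ∧ le t x ∧ not (le x t)) els)))
           (filterᵇ (λ a → le a x) els))

-- fuel = number of elements of the poset, which exceeds every chain length
rulerGrundy : {A : Set} → List A → (A → A → Bool) → A → ℕ
rulerGrundy els le = rulerGrundyF els le (length els)

record FiniteField : Set₁ where
  field
    Carrier : Set
    _+_ _*_ : Carrier → Carrier → Carrier
    -_      : Carrier → Carrier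
    0# 1#   : Carrier
    isCommutativeRing : IsCommutativeRing _≡_ _+_ _*_ -_ 0# 1#
    0≢1     : 0# ≢ 1#
    inverse : ∀ x → x ≢ 0# → Σ Carrier (λ y → x * y ≡ 1#)
    _≟_     : DecidableEquality Carrier
    elements : List Carrier
    elements-complete : ∀ x → x ∈ elements
    elements-unique   : Unique elements

  size : ℕ
  size = length elements

module _ (F : FiniteField) where
  open FiniteField F

  vecs : (n : ℕ) → List (Vec Carrier n)
  vecs zero    = [] ∷ []
  vecs (suc n) = concatMap (λ a → map (a ∷_) (vecs n)) elements

  _≟v_ : ∀ {n} → DecidableEquality (Vec Carrier n)
  _≟v_ = Data.Vec.Properties.≡-dec _≟_
    where import Data.Vec.Properties

  zeroV : ∀ n → Vec Carrier n
  zeroV n = replicate n 0#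

  _+v_ : ∀ {n} → Vec Carrier n → Vec Carrier n → Vec Carrier n
  _+v_ = zipWith _+_

  _•_ : ∀ {n} → Carrier → Vec Carrier n → Vec Carrier n
  c • v = Data.Vec.map (c *_) v

  -- A subset of F^n is a list of Booleans, one per element of (vecs n).
  memAux : ∀ {n} → Vec Carrier n → List (Vec Carrier n) → List Bool → Bool
  memAux v (u ∷ us) (b ∷ bs) = (b ∧ does (v ≟v u)) ∨ memAux v us bs
  memAux v _        _        = false

  mem : ∀ {n} → Vec Carrier n → List Bool → Bool
  mem {n} v S = memAux v (vecs n) S

  allBool : ∀ {X : Set} → (X → Bool) → List X → Bool
  allBool p = foldr (λ x r → p x ∧ r) true

  isSubspace : ∀ n → List Bool → Bool
  isSubspace n S =
    mem (zeroV n) S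
    ∧ allBool (λ u → allBool (λ v → not (mem u S ∧ mem v S) ∨ mem (u +v v) S) (vecs n)) (vecs n)
    ∧ allBool (λ c → allBool (λ u → not (mem u S) ∨ mem (c • u) S) (vecs n)) elements

  allSubsets : ℕ → List (List Bool)
  allSubsets zero    = [] ∷ []
  allSubsets (suc m) = map (true ∷_) (allSubsets m) Data.List.++ map (false ∷_) (allSubsets m)

  subspaces : ℕ → List (List Bool)
  subspaces n = filterᵇ (isSubspace n)
                       (allSubsets (length (vecs n)))

  ⊆ᵇ : List Bool → List Bool → Bool
  ⊆ᵇ (a ∷ as) (b ∷ bs) = (not a ∨ b) ∧ ⊆ᵇ as bs
  ⊆ᵇ _        _        = true

  grundyB : ∀ n → List Bool → ℕ
  grundyB n W = rulerGrundy (subspaces n) ⊆ᵇ W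

  fullSpace : ∀ d → List Bool
  fullSpace d = Data.List.replicate (length (vecs d)) true

  gq : ℕ → ℕ
  gq d = grundyB d (fullSpace d)

  lincomb : ∀ {n d} → Vec Carrier d → Vec (Vec Carrier n) d → Vec Carrier n
  lincomb {n} []       []       = zeroV n
  lincomb     (c ∷ cs) (v ∷ vs) = (c • v) +v lincomb cs vs

  HasDim : ∀ n → List Bool → ℕ → Set
  HasDim n W d = Σ (Vec (Vec Carrier n) d) λ basis →
      Data.Vec.Relation.Unary.All.All (λ v → mem v W ≡ true) basis
    × (∀ cs → lincomb cs basis ≡ zeroV n → cs ≡ replicate d 0#)
    × (∀ w → mem w W ≡ true → Σ (Vec Carrier d) λ cs → lincomb cs basis ≡ w)
    where import Data.Vec.Relation.Unary.All

{-# OPTIONS --safe #-}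
module Submission where

-- Let p be the join of a with a line ⟨e⟩ ⊆ W outside a. Grouping the members t of [a, W] by
-- their join u with ⟨e⟩ reduces the nim-sum over [a, W] to one over [p, W], once the parity of
-- the number of hyperplanes t ⊇ a of u avoiding e is known. That parity is found by letting the
-- involution x ↦ x + φ(x) e act, where φ is a functional with φ|a = 0 and φ(e) = −2: for q odd it
-- is a reflection and ker φ ∩ u is the only fixed hyperplane; for q even and u ≠ p it is a
-- transvection, which for φ|p = 0 and φ|u ≠ 0 fixes none.
--
-- For q odd the sum over [a, W] of values obeying G(k) ⊕ G(k+1) = G(k+2) is thus G(2 dim W − dim a);
-- for q even the sum of values G(k) = T(k) ⊕ T(k+1) telescopes to T(dim a) ⊕ T(dim W + 1), and
-- the Gray code T makes G(k) the largest power of 2 dividing k + 1.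

-- The recursion determines the Grundy values, so it suffices to guess a function of the dimension
-- and to verify the mex equation for it. The move that turns [a, W] leads to a value g(W) ⊕ S(a),
-- with S(a) the nim-sum of g over the whole interval; the obstacle is to find S(a) in closed form,
-- although [a, W] contains huge numbers of subspaces of each dimension.
--
-- Only parities of these numbers matter, because subspaces of equal dimension carry equal values.
-- With k = dim u - dim a, the hyperplanes t ⊇ a of u that avoid e number q^(k-1): always odd for q
-- odd, and for q even odd only when k = 1, that is u = p. An involution yields this parity without
-- any counting. Which case applies is governed by whether 1 + 1 = 0 in the field, and the same
-- pairing argument links that condition to the parity of q.

open import Defs
open import Algebra.Bundles using (CommutativeRing)
import Algebra.Properties.Ring
open import Data.Bool using (Bool; true; false; not; _∧_; _∨_; _xor_; T; T?; if_then_else_)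
import Data.Bool
open import Data.Bool.Properties using (∧-assoc; ∧-conicalˡ; ∧-conicalʳ; T-≡; xor-comm; xor-assoc; xor-same; not-involutive)
open import Data.Fin using (Fin)
open import Data.Fin.Properties using (toℕ<n; toℕ-injective; injective⇒≤)
open import Data.List using (List; []; _∷_; map; filterᵇ; length; lookup; concatMap; replicate)
import Data.List.Properties
open import Data.List.Properties using (map-cong; map-cong-local; filter-notAll; length-map; ∷-injectiveʳ; length-replicate)
open import Data.List.Membership.Propositional using (_∈_; _∉_; lose; find)
open import Data.List.Membership.Propositional.Properties using (∈-filter⁺; ∈-filter⁻; ∈-map⁺; ∈-map⁻; ∈-++⁺ˡ; ∈-++⁺ʳ; ∈-++⁻; ∈-concatMap⁺; ∈-concatMap⁻)
import Data.List.Relation.Unary.All as All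
open import Data.List.Relation.Unary.AllPairs using ([]; _∷_)
open import Data.List.Relation.Unary.Any as Any using (Any; here; there; index)
open import Data.List.Relation.Unary.Any.Properties using (lookup-index)
open import Data.List.Relation.Unary.Unique.Propositional using (Unique)
open import Data.List.Relation.Unary.Unique.Propositional.Properties using (map⁺; ++⁺; filter⁺)
open import Data.Nat using (ℕ; zero; suc; pred; _+_; _*_; _∸_; _^_; _%_; _/_; _≤_; _<_; z≤n; s≤s; _≡ᵇ_)
open import Data.Nat.Divisibility using (_∣_; divides; divides-refl)
open import Data.Nat.DivMod using ([m+kn]%n≡m%n; [m+n]%n≡m%n; m*n/n≡m; +-distrib-/-∣ʳ; m/n<m)
open import Data.Nat.Induction using (<-rec)
open import Data.Nat.Properties
open import Data.Product using (Σ; _×_; _,_; proj₁; proj₂; ∃; ∃₂)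
open import Data.Sum using (_⊎_; inj₁; inj₂)
open import Data.Vec as Vec using (Vec; []; _∷_)
import Data.Vec.Properties as Vecₚ
open import Data.Vec.Relation.Unary.All using ([]; _∷_) renaming (All to Allᵛ)
open import Function using (_∘_; Equivalence)
open import Level using (0ℓ)
open import Relation.Binary.Definitions using (DecidableEquality)
open import Relation.Binary.PropositionalEquality
open import Relation.Nullary using (¬_; Dec; yes; no; does; contradiction)
open import Relation.Nullary.Decidable using (dec-true; dec-false; map′; decidable-stable)

-- Nim-addition and the Gray code

bit : Bool → ℕ
bit false = 0
bit true  = 1

infixr 5 _∷₂_

_∷₂_ : Bool → ℕ → ℕ
b ∷₂ m = bit b + 2 * m

∷₂-% : ∀ b m → (b ∷₂ m) % 2 ≡ bit b
∷₂-% b m rewrite *-comm 2 m with b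
... | false = [m+kn]%n≡m%n 0 m 2
... | true  = [m+kn]%n≡m%n 1 m 2

∷₂-/ : ∀ b m → (b ∷₂ m) / 2 ≡ m
∷₂-/ b m rewrite *-comm 2 m with b
... | false = m*n/n≡m m 2
... | true  = trans (+-distrib-/-∣ʳ 1 {d = 2} (divides-refl m)) (m*n/n≡m m 2)

binary : ∀ n → ∃₂ λ b m → n ≡ b ∷₂ m
binary zero = false , 0 , refl
binary (suc n) with binary n
... | false , m , refl = true , m , refl
... | true  , m , refl = false , suc m , sym (*-suc 2 m)

∷₂-<ʳ : ∀ b m → ¬ (b ∷₂ m ≡ 0) → m < b ∷₂ m
∷₂-<ʳ false zero    ne = contradiction refl ne
∷₂-<ʳ false (suc m) _  = m<m+n (suc m) (s≤s z≤n)
∷₂-<ʳ true  m       _  = s≤s (m≤m+n m (m + 0))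

-- `0` is a separate case because `false ∷₂ 0` is `0` again; every other number has a strictly
-- smaller tail. Both `_⊕_` and `gray` act digit by digit, so this is the induction that suits them.
binary-ind : (P : ℕ → Set) → P 0 → (∀ b m → P m → P (b ∷₂ m)) → ∀ n → P n
binary-ind P P0 P∷ = <-rec P step
  where
  step : ∀ n → (∀ {m} → m < n → P m) → P n
  step n rec with n ≟ 0 | binary n
  ... | yes refl | _              = P0
  ... | no  ne   | b , m , refl = P∷ b m (rec (∷₂-<ʳ b m ne))

xorF-0-0 : ∀ k → xorF k 0 0 ≡ 0
xorF-0-0 zero    = refl
xorF-0-0 (suc k) rewrite xorF-0-0 k = refl

half≤ : ∀ {m k} → m ≤ suc k → m / 2 ≤ k
half≤ {zero}  _         = z≤n
half≤ {suc m} (s≤s m≤k) = ≤-trans (≤-pred (m/n<m (suc m) 2 (s≤s (s≤s z≤n)))) m≤k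

-- Each round halves both arguments, so a common bound on them drops by at least one together with
-- the fuel; fuel beyond that bound only produces zero digits. `_⊕_` picks its fuel from its
-- arguments, so its recursive unfolding needs this independence.
xorF-fuel : ∀ k l {m n} → m ≤ k → n ≤ k → m ≤ l → n ≤ l → xorF k m n ≡ xorF l m n
xorF-fuel zero    l       z≤n z≤n _ _ = sym (xorF-0-0 l)
xorF-fuel (suc k) zero    _ _ z≤n z≤n = xorF-0-0 (suc k)
xorF-fuel (suc k) (suc l) {m} {n} p q r s =
  cong (λ x → (if (m % 2) ≡ᵇ (n % 2) then 0 else 1) + 2 * x)
       (xorF-fuel k l (half≤ p) (half≤ q) (half≤ r) (half≤ s))

⊕-fuel : ∀ k {m n} → m ≤ k → n ≤ k → m ⊕ n ≡ xorF k m n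
⊕-fuel k {m} {n} p q = xorF-fuel (m + n) k (m≤m+n m n) (m≤n+m n m) p q

bit-xor : ∀ a b → (if bit a ≡ᵇ bit b then 0 else 1) ≡ bit (a xor b)
bit-xor false false = refl
bit-xor false true  = refl
bit-xor true  false = refl
bit-xor true  true  = refl

-- The fuel is replaced by a visible successor, so that `xorF` unfolds exactly once, and is then
-- traded for the fuel of the tails. All algebra of `_⊕_` below rests on this digit rule.
∷₂-⊕ : ∀ a m b n → (a ∷₂ m) ⊕ (b ∷₂ n) ≡ (a xor b) ∷₂ (m ⊕ n)
∷₂-⊕ a m b n = begin
  (a ∷₂ m) ⊕ (b ∷₂ n)
    ≡⟨ ⊕-fuel (suc k) {a ∷₂ m} {b ∷₂ n} (≤-trans (m≤m+n _ _) (n≤1+n _)) (≤-trans (m≤n+m _ (a ∷₂ m)) (n≤1+n _)) ⟩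
  xorF (suc k) (a ∷₂ m) (b ∷₂ n)
    ≡⟨ cong₂ (λ x y → (if x ≡ᵇ y then 0 else 1) + 2 * xorF k ((a ∷₂ m) / 2) ((b ∷₂ n) / 2)) (∷₂-% a m) (∷₂-% b n) ⟩
  (if bit a ≡ᵇ bit b then 0 else 1) + 2 * xorF k ((a ∷₂ m) / 2) ((b ∷₂ n) / 2)
    ≡⟨ cong₂ (λ x y → x + 2 * y) (bit-xor a b) (cong₂ (xorF k) (∷₂-/ a m) (∷₂-/ b n)) ⟩
  bit (a xor b) + 2 * xorF k m n
    ≡⟨ cong (λ x → bit (a xor b) + 2 * x) (⊕-fuel k (≤-trans (≤-∷₂ a m) (m≤m+n _ _)) (≤-trans (≤-∷₂ b n) (m≤n+m _ (a ∷₂ m)))) ⟨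
  (a xor b) ∷₂ (m ⊕ n) ∎
  where
  open ≡-Reasoning
  k = (a ∷₂ m) + (b ∷₂ n)
  ≤-∷₂ : ∀ c i → i ≤ c ∷₂ i
  ≤-∷₂ c i = ≤-trans (m≤m+n i (i + 0)) (m≤n+m (2 * i) (bit c))

⊕-identityˡ : ∀ n → 0 ⊕ n ≡ n
⊕-identityˡ = binary-ind _ refl λ b m ih → trans (∷₂-⊕ false 0 b m) (cong (b ∷₂_) ih)

⊕-comm : ∀ m n → m ⊕ n ≡ n ⊕ m
⊕-comm m n = binary-ind (λ m → ∀ n → m ⊕ n ≡ n ⊕ m) base step m n
  where
  base : ∀ n → 0 ⊕ n ≡ n ⊕ 0
  base = binary-ind _ refl λ b m ih → trans (∷₂-⊕ false 0 b m)
    (trans (cong₂ _∷₂_ (xor-comm false b) ih) (sym (∷₂-⊕ b m false 0)))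
  step : ∀ b m → (∀ n → m ⊕ n ≡ n ⊕ m) → ∀ n → (b ∷₂ m) ⊕ n ≡ n ⊕ (b ∷₂ m)
  step b m ih n with binary n
  ... | c , n , refl = trans (∷₂-⊕ b m c n) (trans (cong₂ _∷₂_ (xor-comm b c) (ih n)) (sym (∷₂-⊕ c n b m)))

⊕-identityʳ : ∀ n → n ⊕ 0 ≡ n
⊕-identityʳ n = trans (⊕-comm n 0) (⊕-identityˡ n)

⊕-assoc : ∀ m n o → (m ⊕ n) ⊕ o ≡ m ⊕ (n ⊕ o)
⊕-assoc = binary-ind _
  (λ n o → trans (cong (_⊕ o) (⊕-identityˡ n)) (sym (⊕-identityˡ (n ⊕ o)))) step
  where
  step : ∀ b m → (∀ n o → (m ⊕ n) ⊕ o ≡ m ⊕ (n ⊕ o)) →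
         ∀ n o → ((b ∷₂ m) ⊕ n) ⊕ o ≡ (b ∷₂ m) ⊕ (n ⊕ o)
  step b m ih n o with binary n | binary o
  ... | c , n , refl | d , o , refl
    rewrite ∷₂-⊕ b m c n | ∷₂-⊕ c n d o | ∷₂-⊕ (b xor c) (m ⊕ n) d o | ∷₂-⊕ b m (c xor d) (n ⊕ o)
    = cong₂ _∷₂_ (xor-assoc b c d) (ih n o)

⊕-self : ∀ n → n ⊕ n ≡ 0
⊕-self = binary-ind _ refl λ b m ih → trans (∷₂-⊕ b m b m) (cong₂ _∷₂_ (xor-same b) ih)

⊕-cancelˡ : ∀ m n → m ⊕ (m ⊕ n) ≡ n
⊕-cancelˡ m n = trans (sym (⊕-assoc m m n)) (trans (cong (_⊕ n) (⊕-self m)) (⊕-identityˡ n))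

⊕-interchange : ∀ a b c d → (a ⊕ b) ⊕ (c ⊕ d) ≡ (a ⊕ c) ⊕ (b ⊕ d)
⊕-interchange a b c d = begin
  (a ⊕ b) ⊕ (c ⊕ d) ≡⟨ ⊕-assoc a b (c ⊕ d) ⟩
  a ⊕ (b ⊕ (c ⊕ d)) ≡⟨ cong (a ⊕_) (⊕-assoc b c d) ⟨
  a ⊕ ((b ⊕ c) ⊕ d) ≡⟨ cong (λ x → a ⊕ (x ⊕ d)) (⊕-comm b c) ⟩
  a ⊕ ((c ⊕ b) ⊕ d) ≡⟨ cong (a ⊕_) (⊕-assoc c b d) ⟩
  a ⊕ (c ⊕ (b ⊕ d)) ≡⟨ ⊕-assoc a c (b ⊕ d) ⟨
  (a ⊕ c) ⊕ (b ⊕ d) ∎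
  where open ≡-Reasoning

gray : ℕ → ℕ
gray n = n ⊕ (n / 2)

odd : ℕ → Bool
odd zero    = false
odd (suc n) = not (odd n)

odd-double : ∀ m → odd (2 * m) ≡ false
odd-double zero    = refl
odd-double (suc m) = trans (cong odd (*-suc 2 m)) (trans (not-involutive _) (odd-double m))

odd-∷₂ : ∀ b m → odd (b ∷₂ m) ≡ b
odd-∷₂ false m = odd-double m
odd-∷₂ true  m = cong not (odd-double m)

-- A Gray digit is the xor of two adjacent binary digits, and the binary digit next to `b` is the
-- parity of `m`.
gray-∷₂ : ∀ b m → gray (b ∷₂ m) ≡ (b xor odd m) ∷₂ gray m
gray-∷₂ b m with binary m
... | c , m′ , refl = begin
  (b ∷₂ m) ⊕ ((b ∷₂ m) / 2)  ≡⟨ cong ((b ∷₂ m) ⊕_) (∷₂-/ b m) ⟩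
  (b ∷₂ m) ⊕ (c ∷₂ m′)       ≡⟨ ∷₂-⊕ b m c m′ ⟩
  (b xor c) ∷₂ (m ⊕ m′)      ≡⟨ cong₂ (λ x y → (b xor x) ∷₂ (m ⊕ y)) (odd-∷₂ c m′) (∷₂-/ c m′) ⟨
  (b xor odd m) ∷₂ gray m ∎
  where open ≡-Reasoning

∷₂-injective : ∀ {a b m n} → a ∷₂ m ≡ b ∷₂ n → a ≡ b × m ≡ n
∷₂-injective {a} {b} {m} {n} eq =
  trans (sym (odd-∷₂ a m)) (trans (cong odd eq) (odd-∷₂ b n)) ,
  trans (sym (∷₂-/ a m)) (trans (cong (_/ 2) eq) (∷₂-/ b n))

xor-cancelʳ : ∀ {a b} c → a xor c ≡ b xor c → a ≡ b
xor-cancelʳ {false} {false} _ _ = refl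
xor-cancelʳ {true}  {true}  _ _ = refl
xor-cancelʳ {false} {true}  false ()
xor-cancelʳ {false} {true}  true  ()
xor-cancelʳ {true}  {false} false ()
xor-cancelʳ {true}  {false} true  ()

-- Decoding runs from the top digit down: the induction hypothesis first identifies the tails, after
-- which their common parity cancels from the lowest Gray digits.
gray-injective : ∀ m n → gray m ≡ gray n → m ≡ n
gray-injective = binary-ind _ base step
  where
  base : ∀ n → 0 ≡ gray n → 0 ≡ n
  base = binary-ind _ (λ _ → refl) λ b m ih eq → help b m ih (∷₂-injective {false} {b xor odd m} (trans eq (gray-∷₂ b m)))
    where
    help : ∀ b m → (0 ≡ gray m → 0 ≡ m) → false ≡ b xor odd m × 0 ≡ gray m → 0 ≡ b ∷₂ m
    help b m ih (p , q) with ih q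
    help false .0 ih (p , q) | refl = refl
    help true  .0 ih (() , q) | refl
  step : ∀ b m → (∀ n → gray m ≡ gray n → m ≡ n) → ∀ n → gray (b ∷₂ m) ≡ gray n → b ∷₂ m ≡ n
  step b m ih n eq with binary n
  ... | c , n , refl with ∷₂-injective {b xor odd m} {c xor odd n} (trans (sym (gray-∷₂ b m)) (trans eq (gray-∷₂ c n)))
  ... | p , q with ih n q
  ... | refl = cong (_∷₂ m) (xor-cancelʳ {b} {c} (odd m) p)

m*2n≡2*mn : ∀ m n → m * (2 * n) ≡ 2 * (m * n)
m*2n≡2*mn m n = trans (sym (*-assoc m 2 n)) (trans (cong (_* n) (*-comm m 2)) (*-assoc 2 m n))

-- Consecutive Gray codes differ in one bit. For even `d` it is the lowest; for odd `d` the lowest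
-- Gray digits agree and the question passes to the halves. The two divisibility clauses say that
-- `k` is the 2-adic valuation of `suc d`.
gray-suc : ∀ d → ∃ λ k → gray d ⊕ gray (suc d) ≡ 2 ^ k × 2 ^ k ∣ suc d × ¬ (2 ^ suc k ∣ suc d)
gray-suc = <-rec _ step
  where
  step : ∀ d → (∀ {e} → e < d → ∃ λ k → gray e ⊕ gray (suc e) ≡ 2 ^ k × 2 ^ k ∣ suc e × ¬ (2 ^ suc k ∣ suc e)) →
         ∃ λ k → gray d ⊕ gray (suc d) ≡ 2 ^ k × 2 ^ k ∣ suc d × ¬ (2 ^ suc k ∣ suc d)
  step d rec with binary d
  ... | false , m , refl = 0 , eq , divides (suc (2 * m)) (sym (*-identityʳ _)) , λ where
          (divides r e) → contradiction (trans (sym (odd-∷₂ true m)) (trans (cong odd (trans e (*-comm r 2))) (odd-∷₂ false r))) λ ()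
    where
    open ≡-Reasoning
    lem : ∀ x → x xor (true xor x) ≡ true
    lem false = refl
    lem true  = refl
    eq : gray (false ∷₂ m) ⊕ gray (true ∷₂ m) ≡ 1
    eq = begin
      gray (false ∷₂ m) ⊕ gray (true ∷₂ m)  ≡⟨ cong₂ _⊕_ (gray-∷₂ false m) (gray-∷₂ true m) ⟩
      (odd m ∷₂ gray m) ⊕ ((true xor odd m) ∷₂ gray m)  ≡⟨ ∷₂-⊕ (odd m) (gray m) _ _ ⟩
      (odd m xor (true xor odd m)) ∷₂ (gray m ⊕ gray m) ≡⟨ cong₂ _∷₂_ (lem (odd m)) (⊕-self (gray m)) ⟩
      1 ∎
  ... | true , m , refl with rec (∷₂-<ʳ true m λ ())
  ... | k , e , divides r e′ , nd = suc k , eq , divides r e″ , λ where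
          (divides s f) → nd (divides s (*-cancelˡ-≡ (suc m) (s * 2 ^ suc k) 2
            (trans (*-suc 2 m) (trans f (m*2n≡2*mn s (2 ^ suc k))))))
    where
    open ≡-Reasoning
    e″ : suc (true ∷₂ m) ≡ r * (2 * 2 ^ k)
    e″ = trans (sym (*-suc 2 m)) (trans (cong (2 *_) e′) (sym (m*2n≡2*mn r (2 ^ k))))
    eq : gray (true ∷₂ m) ⊕ gray (suc (true ∷₂ m)) ≡ 2 * 2 ^ k
    eq = begin
      gray (true ∷₂ m) ⊕ gray (suc (true ∷₂ m))  ≡⟨ cong (λ x → gray (true ∷₂ m) ⊕ gray x) (*-suc 2 m) ⟨
      gray (true ∷₂ m) ⊕ gray (false ∷₂ suc m)   ≡⟨ cong₂ _⊕_ (gray-∷₂ true m) (gray-∷₂ false (suc m)) ⟩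
      (not (odd m) ∷₂ gray m) ⊕ (not (odd m) ∷₂ gray (suc m)) ≡⟨ ∷₂-⊕ (not (odd m)) (gray m) _ _ ⟩
      (not (odd m) xor not (odd m)) ∷₂ (gray m ⊕ gray (suc m)) ≡⟨ cong₂ _∷₂_ (xor-same (not (odd m))) e ⟩
      2 * 2 ^ k ∎

-- Because 2^k divides d + 1, the binary expansion of d ends in k ones. Changing these k digits at
-- will keeps the number at most d, and the Gray codes obtained differ from that of d by every
-- pattern of k low digits. This supplies all options below the claimed Grundy value.
gray-block : ∀ k d c → 2 ^ k ∣ suc d → c < 2 ^ k → ∃ λ i → i ≤ d × gray i ⊕ gray d ≡ c
gray-block zero d zero _ _ = d , ≤-refl , ⊕-self (gray d)
gray-block zero d (suc c) _ (s≤s ())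
gray-block (suc k) d c (divides r e) c<2^ with binary d | binary c
... | false , m , refl | _ = contradiction
        (trans (sym (odd-∷₂ true m)) (trans (cong odd (trans e (m*2n≡2*mn r (2 ^ k)))) (odd-∷₂ false (r * 2 ^ k)))) λ ()
... | true , m , refl | b , c , refl with gray-block k m c (divides r e′) c<
  where
  e′ : suc m ≡ r * 2 ^ k
  e′ = *-cancelˡ-≡ (suc m) (r * 2 ^ k) 2
         (trans (*-suc 2 m) (trans e (m*2n≡2*mn r (2 ^ k))))
  c< : c < 2 ^ k
  c< = *-cancelˡ-< 2 c (2 ^ k) (≤-<-trans (m≤n+m (2 * c) (bit b)) c<2^)
... | i , i≤m , eq = (x ∷₂ i) , bound x , eq′
  where
  open ≡-Reasoning
  y = true xor odd m
  -- `y` is the lowest Gray digit of the given number, and `x` solves `(x xor odd i) xor y ≡ b`.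
  -- Either digit keeps the bound, since the given number ends in `true`.
  x = (b xor y) xor odd i
  bound : ∀ x → x ∷₂ i ≤ true ∷₂ m
  bound false = ≤-trans (*-monoʳ-≤ 2 i≤m) (n≤1+n _)
  bound true  = s≤s (*-monoʳ-≤ 2 i≤m)
  cancel : ∀ a b → (a xor b) xor b ≡ a
  cancel a b = trans (xor-assoc a b b) (trans (cong (a xor_) (xor-same b)) (xor-comm a false))
  eq′ : gray (x ∷₂ i) ⊕ gray (true ∷₂ m) ≡ b ∷₂ c
  eq′ = begin
    gray (x ∷₂ i) ⊕ gray (true ∷₂ m) ≡⟨ cong₂ _⊕_ (gray-∷₂ x i) (gray-∷₂ true m) ⟩
    ((x xor odd i) ∷₂ gray i) ⊕ (y ∷₂ gray m) ≡⟨ ∷₂-⊕ (x xor odd i) (gray i) y (gray m) ⟩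
    ((x xor odd i) xor y) ∷₂ (gray i ⊕ gray m) ≡⟨ cong₂ (λ u v → (u xor y) ∷₂ v) (cancel (b xor y) (odd i)) eq ⟩
    ((b xor y) xor y) ∷₂ c ≡⟨ cong (_∷₂ c) (cancel b y) ⟩
    b ∷₂ c ∎

-- Minimal excludants, fuel and nim-sums over lists

≡true-ext : ∀ {a b} → (a ≡ true → b ≡ true) → (b ≡ true → a ≡ true) → a ≡ b
≡true-ext {false} {false} _ _ = refl
≡true-ext {false} {true}  _ g = g refl
≡true-ext {true}  {b}     f _ = sym (f refl)

∧-true : ∀ {a b} → a ≡ true → b ≡ true → a ∧ b ≡ true
∧-true refl refl = refl

∧-elim : ∀ {a b} → a ∧ b ≡ true → a ≡ true × b ≡ true
∧-elim {a} {b} p = ∧-conicalˡ a b p , ∧-conicalʳ a b p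

not-true : ∀ {a} → ¬ (a ≡ true) → not a ≡ true
not-true {false} _ = refl
not-true {true}  n = contradiction refl n

not-elim : ∀ {a} → not a ≡ true → ¬ (a ≡ true)
not-elim {true} ()
not-elim {false} _ ()

does-elim : ∀ {A : Set} (a? : Dec A) → does a? ≡ true → A
does-elim (yes a) _ = a

∈-filterᵇ⁺ : ∀ {A : Set} (p : A → Bool) {x xs} → x ∈ xs → p x ≡ true → x ∈ filterᵇ p xs
∈-filterᵇ⁺ p x∈ px = ∈-filter⁺ (T? ∘ p) x∈ (Equivalence.from T-≡ px)

∈-filterᵇ⁻ : ∀ {A : Set} (p : A → Bool) {x xs} → x ∈ filterᵇ p xs → x ∈ xs × p x ≡ true
∈-filterᵇ⁻ p x∈ with ∈-filter⁻ (T? ∘ p) x∈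
... | x∈xs , t = x∈xs , Equivalence.to T-≡ t

elemℕ⁺ : ∀ {i l} → i ∈ l → elemℕ i l ≡ true
elemℕ⁺ {i} (here refl) rewrite Equivalence.to T-≡ (≡⇒≡ᵇ i i refl) = refl
elemℕ⁺ {i} {j ∷ l} (there i∈) with i ≡ᵇ j
... | true  = refl
... | false = elemℕ⁺ i∈

elemℕ⁻ : ∀ {i} l → elemℕ i l ≡ true → i ∈ l
elemℕ⁻ {i} (j ∷ l) p with i ≡ᵇ j in eq
... | true  = here (≡ᵇ⇒≡ i j (Equivalence.from T-≡ eq))
... | false = there (elemℕ⁻ l p)

mexAux-correct : ∀ k i l {v} → (∀ {j} → j < v → j ∈ l) → v ∉ l → i ≤ v → v ≤ i + k → mexAux k i l ≡ v
mexAux-correct zero i l below v∉ i≤v v≤i rewrite +-identityʳ i = ≤-antisym i≤v v≤i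
mexAux-correct (suc k) i l {v} below v∉ i≤v v≤ with m≤n⇒m<n∨m≡n i≤v
... | inj₁ i<v rewrite elemℕ⁺ (below i<v) =
        mexAux-correct k (suc i) l below v∉ i<v (≤-trans v≤ (≤-reflexive (+-suc i k)))
... | inj₂ refl with elemℕ i l in eq
...   | true  = contradiction (elemℕ⁻ l eq) v∉
...   | false = refl

-- The numbers below `v` occupy distinct positions of `l`, so `v` is at most `length l`, the fuel
-- that `mex` starts with.
mex-correct : ∀ l {v} → (∀ {j} → j < v → j ∈ l) → v ∉ l → mex l ≡ v
mex-correct l {v} below v∉ = mexAux-correct (length l) 0 l below v∉ z≤n (injective⇒≤ inj)
  where
  pos : Fin v → Fin (length l)
  pos i = index (below (toℕ<n i))
  inj : ∀ {i j} → pos i ≡ pos j → i ≡ j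
  inj {i} {j} eq = toℕ-injective (trans (lookup-index (below (toℕ<n i)))
    (trans (cong (lookup l) eq) (sym (lookup-index (below (toℕ<n j))))))

module _ {A : Set} where

  length-filterᵇ-mono : ∀ {p q : A → Bool} xs → (∀ {y} → y ∈ xs → p y ≡ true → q y ≡ true) →
                        length (filterᵇ p xs) ≤ length (filterᵇ q xs)
  length-filterᵇ-mono [] _ = z≤n
  length-filterᵇ-mono {p} {q} (x ∷ xs) p⇒q with p x in px | q x in qx
  ... | true  | true  = s≤s (length-filterᵇ-mono xs (p⇒q ∘ there))
  ... | true  | false = contradiction (trans (sym qx) (p⇒q (here refl) px)) λ ()
  ... | false | true  = m≤n⇒m≤1+n (length-filterᵇ-mono xs (p⇒q ∘ there))
  ... | false | false = length-filterᵇ-mono xs (p⇒q ∘ there)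

  length-filterᵇ-< : ∀ {p q : A → Bool} {z} xs → (∀ {y} → y ∈ xs → p y ≡ true → q y ≡ true) →
                     z ∈ xs → p z ≡ false → q z ≡ true →
                     length (filterᵇ p xs) < length (filterᵇ q xs)
  length-filterᵇ-< (x ∷ xs) p⇒q (here refl) pz qz rewrite pz | qz =
    s≤s (length-filterᵇ-mono xs (p⇒q ∘ there))
  length-filterᵇ-< {p} {q} (x ∷ xs) p⇒q (there z∈) pz qz with p x in px | q x in qx
  ... | true  | true  = s≤s (length-filterᵇ-< xs (p⇒q ∘ there) z∈ pz qz)
  ... | true  | false = contradiction (trans (sym qx) (p⇒q (here refl) px)) λ ()
  ... | false | true  = m≤n⇒m≤1+n (length-filterᵇ-< xs (p⇒q ∘ there) z∈ pz qz)
  ... | false | false = length-filterᵇ-< xs (p⇒q ∘ there) z∈ pz qz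

  rulerOptions : List A → (A → A → Bool) → (A → ℕ) → A → List ℕ
  rulerOptions els le g x = map (λ a → nimSum (map g (filterᵇ (λ t → le a t ∧ le t x ∧ not (le x t)) els)))
                                (filterᵇ (λ a → le a x) els)

  -- Transitivity is asked for on `els` only: `⊆ᵇ` compares lists up to the end of the shorter one
  -- and is transitive among lists of equal length, but not in general.
  module _ (els : List A) (le : A → A → Bool)
    (le-trans : ∀ {x y z} → x ∈ els → y ∈ els → z ∈ els → le x y ≡ true → le y z ≡ true → le x z ≡ true)
    where

    private
      lt : A → A → Bool
      lt t x = le t x ∧ not (le x t)

      lt-trans : ∀ {x y z} → x ∈ els → y ∈ els → z ∈ els → lt x y ≡ true → lt y z ≡ true → lt x z ≡ true
      lt-trans x∈ y∈ z∈ p q with ∧-elim p | ∧-elim q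
      ... | x≤y , y≰x | y≤z , z≰y =
        ∧-true (le-trans x∈ y∈ z∈ x≤y y≤z) (not-true λ z≤x → not-elim z≰y (le-trans z∈ x∈ y∈ z≤x x≤y))

      lt-irrefl : ∀ x → lt x x ≡ false
      lt-irrefl x with le x x
      ... | true  = refl
      ... | false = refl

      below : A → ℕ
      below x = length (filterᵇ (λ t → lt t x) els)

      below-mono : ∀ {x y} → x ∈ els → y ∈ els → lt x y ≡ true → below x < below y
      below-mono {x} x∈ y∈ x<y =
        length-filterᵇ-< els (λ z∈ z<x → lt-trans z∈ x∈ y∈ z<x x<y) x∈ (lt-irrefl x) x<y

      below<length : ∀ {x} → x ∈ els → below x < length els
      below<length {x} x∈ = filter-notAll (λ t → T? (lt t x)) els (none x∈)
        where
        none : ∀ {xs} → x ∈ xs → Any (λ t → ¬ T (lt t x)) xs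
        none (here refl) = here (subst (¬_ ∘ T) (sym (lt-irrefl x)) λ ())
        none (there p)   = there (none p)

    -- The fuel suffices because every move strictly decreases the number of elements below.
    rulerGrundy-unique : (g : A → ℕ) → (∀ {x} → x ∈ els → mex (rulerOptions els le g x) ≡ g x) →
                         ∀ {x} → x ∈ els → rulerGrundy els le x ≡ g x
    rulerGrundy-unique g g-mex x∈ = go (length els) x∈ (below<length x∈)
      where
      go : ∀ k {x} → x ∈ els → below x < k → rulerGrundyF els le k x ≡ g x
      go (suc k) {x} x∈ (s≤s b≤k) = trans (cong mex (map-cong (λ a → cong nimSum (map-cong-local (All.tabulate (rec a))))
                                                    (filterᵇ (λ a → le a x) els)))
                                          (g-mex x∈)
        where
        rec : ∀ a {t} → t ∈ filterᵇ (λ t → le a t ∧ le t x ∧ not (le x t)) els → rulerGrundyF els le k t ≡ g t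
        rec a t∈ with ∈-filterᵇ⁻ _ t∈
        ... | t∈els , p = go k t∈els (≤-trans (below-mono t∈els x∈ (proj₂ (∧-elim {le a _} p))) b≤k)

-- A sum over a subset is written over the full list with `0` outside the subset. The index list
-- then never changes, and double sums can be exchanged freely.
guard : Bool → ℕ → ℕ
guard b x = if b then x else 0

guard-⊕ : ∀ b x y → guard b (x ⊕ y) ≡ guard b x ⊕ guard b y
guard-⊕ true  x y = refl
guard-⊕ false x y = refl

guard-cong : ∀ b {x y} → (b ≡ true → x ≡ y) → guard b x ≡ guard b y
guard-cong true  p = p refl
guard-cong false _ = refl

guard-∧ : ∀ a b x → guard a (guard b x) ≡ guard (a ∧ b) x
guard-∧ true  b x = refl
guard-∧ false b x = refl

guard-split : ∀ a b x → guard a x ≡ guard (a ∧ b) x ⊕ guard (a ∧ not b) x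
guard-split false b     x = refl
guard-split true  true  x = sym (⊕-identityʳ x)
guard-split true  false x = sym (⊕-identityˡ x)

guard-0 : ∀ b → guard b 0 ≡ 0
guard-0 true  = refl
guard-0 false = refl

¬guard : ∀ {b x} → ¬ (b ≡ true) → guard b x ≡ 0
¬guard {true}  n = contradiction refl n
¬guard {false} n = refl

⨁ : {A : Set} → List A → (A → ℕ) → ℕ
⨁ xs f = nimSum (map f xs)

module _ {A : Set} where

  ⨁-cong : ∀ xs {f g : A → ℕ} → (∀ {x} → x ∈ xs → f x ≡ g x) → ⨁ xs f ≡ ⨁ xs g
  ⨁-cong []       p = refl
  ⨁-cong (x ∷ xs) p = cong₂ _⊕_ (p (here refl)) (⨁-cong xs (p ∘ there))

  ⨁-⊕ : ∀ xs (f g : A → ℕ) → ⨁ xs (λ x → f x ⊕ g x) ≡ ⨁ xs f ⊕ ⨁ xs g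
  ⨁-⊕ []       f g = refl
  ⨁-⊕ (x ∷ xs) f g = trans (cong ((f x ⊕ g x) ⊕_) (⨁-⊕ xs f g)) (⊕-interchange (f x) (g x) _ _)

  ⨁-0 : ∀ xs {f : A → ℕ} → (∀ {x} → x ∈ xs → f x ≡ 0) → ⨁ xs f ≡ 0
  ⨁-0 []       p = refl
  ⨁-0 (x ∷ xs) p = cong₂ _⊕_ (p (here refl)) (⨁-0 xs (p ∘ there))

  ⨁-guard : ∀ xs b (f : A → ℕ) → ⨁ xs (λ x → guard b (f x)) ≡ guard b (⨁ xs f)
  ⨁-guard xs true  f = refl
  ⨁-guard xs false f = ⨁-0 xs (λ _ → refl)

  ⨁-filterᵇ : ∀ (p : A → Bool) xs f → ⨁ (filterᵇ p xs) f ≡ ⨁ xs (λ x → guard (p x) (f x))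
  ⨁-filterᵇ p []       f = refl
  ⨁-filterᵇ p (x ∷ xs) f with p x
  ... | true  = cong (f x ⊕_) (⨁-filterᵇ p xs f)
  ... | false = trans (⨁-filterᵇ p xs f) (sym (⊕-identityˡ _))

  ⨁-point : ∀ {xs} {f : A → ℕ} {x₀} → Unique xs → x₀ ∈ xs →
            (∀ {x} → x ∈ xs → x ≢ x₀ → f x ≡ 0) → ⨁ xs f ≡ f x₀
  ⨁-point {x ∷ xs} {f} (x∉ ∷ u) (here refl) p =
    trans (cong (f x ⊕_) (⨁-0 xs λ y∈ → p (there y∈) (λ { refl → All.lookup x∉ y∈ refl }))) (⊕-identityʳ (f x))
  ⨁-point {x ∷ xs} {f} (x∉ ∷ u) (there x₀∈) p =
    trans (cong₂ _⊕_ (p (here refl) (λ { refl → All.lookup x∉ x₀∈ refl })) (⨁-point u x₀∈ (p ∘ there))) (⊕-identityˡ _)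

⨁-swap : ∀ {A B : Set} xs ys (f : A → B → ℕ) →
         ⨁ xs (λ x → ⨁ ys (f x)) ≡ ⨁ ys (λ y → ⨁ xs (λ x → f x y))
⨁-swap []       ys f = sym (⨁-0 ys (λ _ → refl))
⨁-swap (x ∷ xs) ys f = trans (cong (⨁ ys (f x) ⊕_) (⨁-swap xs ys f)) (sym (⨁-⊕ ys (f x) _))

module _ {A : Set} where

  -- The terms `f x y` and `f y x` off the diagonal are equal and cancel, as every number is its own
  -- nim-inverse.
  ⨁-symmetric : ∀ xs (f : A → A → ℕ) → (∀ {x y} → x ∈ xs → y ∈ xs → f x y ≡ f y x) →
                ⨁ xs (λ x → ⨁ xs (f x)) ≡ ⨁ xs (λ x → f x x)
  ⨁-symmetric []       f s = refl
  ⨁-symmetric (x ∷ xs) f s = begin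
    (f x x ⊕ r) ⊕ ⨁ xs (λ y → f y x ⊕ ⨁ xs (f y))
      ≡⟨ cong ((f x x ⊕ r) ⊕_) (⨁-⊕ xs (λ y → f y x) _) ⟩
    (f x x ⊕ r) ⊕ (⨁ xs (λ y → f y x) ⊕ ⨁ xs (λ y → ⨁ xs (f y)))
      ≡⟨ cong₂ (λ u v → (f x x ⊕ r) ⊕ (u ⊕ v)) (⨁-cong xs (λ y∈ → s (there y∈) (here refl)))
               (⨁-symmetric xs f (λ p q → s (there p) (there q))) ⟩
    (f x x ⊕ r) ⊕ (r ⊕ ⨁ xs (λ y → f y y))  ≡⟨ ⊕-assoc (f x x) r _ ⟩
    f x x ⊕ (r ⊕ (r ⊕ ⨁ xs (λ y → f y y)))  ≡⟨ cong (f x x ⊕_) (⊕-cancelˡ r _) ⟩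
    f x x ⊕ ⨁ xs (λ y → f y y) ∎
    where
    open ≡-Reasoning
    r = ⨁ xs (f x)

  -- The graph of `σ` is a symmetric relation on the elements selected by `c`, so `⨁-symmetric`
  -- leaves only its diagonal, the fixed points. The summand is a constant `v` so that paired terms
  -- agree.
  ⨁-involution : (_≟_ : DecidableEquality A) (xs : List A) → Unique xs → (c : A → Bool) (σ : A → A) →
    (∀ {x} → x ∈ xs → c x ≡ true → σ x ∈ xs × c (σ x) ≡ true × σ (σ x) ≡ x) →
    ∀ v → ⨁ xs (λ x → guard (c x) v) ≡ ⨁ xs (λ x → guard (c x ∧ does (x ≟ σ x)) v)
  ⨁-involution _≟_ xs u c σ h v = trans (⨁-cong xs spread)
    (⨁-symmetric xs (λ x y → guard (c x ∧ does (y ≟ σ x)) v)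
      λ x∈ y∈ → cong (λ b → guard b v) (≡true-ext (flip x∈) (flip y∈)))
    where
    flip : ∀ {x y} → x ∈ xs → c x ∧ does (y ≟ σ x) ≡ true → c y ∧ does (x ≟ σ y) ≡ true
    flip {x} {y} x∈ p with ∧-elim {c x} p
    ... | cx , q with does-elim (y ≟ σ x) q | h x∈ cx
    ... | refl | _ , cσx , σσx = ∧-true cσx (dec-true (x ≟ σ (σ x)) (sym σσx))
    -- Each term becomes a sum over `y` whose only possibly nonzero term is at `y = σ x`; this
    -- creates the double sum.
    spread : ∀ {x} → x ∈ xs → guard (c x) v ≡ ⨁ xs (λ y → guard (c x ∧ does (y ≟ σ x)) v)
    spread {x} x∈ with c x in eq
    ... | false = sym (⨁-0 xs (λ _ → refl))
    ... | true  = sym (trans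
      (⨁-point u (proj₁ (h x∈ eq)) (λ {y} _ ne → cong (λ b → guard b v) (dec-false (y ≟ σ x) ne)))
      (cong (λ b → guard b v) (dec-true (σ x ≟ σ x) refl)))

-- Linear algebra over a finite field

module LinearAlgebra (F : FiniteField) where

  open FiniteField F public using (Carrier; 0#; 1#; inverse; 0≢1; elements; elements-complete; elements-unique; size; isCommutativeRing)
    renaming (_+_ to infixl 6 _+F_; _*_ to infixl 7 _*F_; -_ to infix 8 -F_; _≟_ to infix 4 _≟F_)

  commutativeRing : CommutativeRing 0ℓ 0ℓ
  commutativeRing = record { isCommutativeRing = isCommutativeRing }

  module R where
    open CommutativeRing commutativeRing public
    open Algebra.Properties.Ring ring public

  infixl 6 _⊞_
  infixr 7 _·_
  infix  4 _∋_ _⊑_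

  V : ℕ → Set
  V = Vec Carrier

  _⊞_ : ∀ {n} → V n → V n → V n
  _⊞_ = _+v_ F

  _·_ : ∀ {n} → Carrier → V n → V n
  _·_ = _•_ F

  𝟎 : ∀ {n} → V n
  𝟎 = zeroV F _

  *F-cancel-0 : ∀ {x y} → x ≢ 0# → y *F x ≡ 0# → y ≡ 0#
  *F-cancel-0 {x} {y} x≢0 eq with inverse x x≢0
  ... | x⁻¹ , inv = begin
    y                 ≡⟨ R.*-identityʳ y ⟨
    y *F 1#           ≡⟨ cong (y *F_) inv ⟨
    y *F (x *F x⁻¹)   ≡⟨ R.*-assoc y x x⁻¹ ⟨
    (y *F x) *F x⁻¹   ≡⟨ cong (_*F x⁻¹) eq ⟩
    0# *F x⁻¹         ≡⟨ R.zeroˡ x⁻¹ ⟩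
    0#                ∎
    where open ≡-Reasoning

  ⊞-assoc : ∀ {n} (x y z : V n) → (x ⊞ y) ⊞ z ≡ x ⊞ (y ⊞ z)
  ⊞-assoc = Vecₚ.zipWith-assoc R.+-assoc

  ⊞-comm : ∀ {n} (x y : V n) → x ⊞ y ≡ y ⊞ x
  ⊞-comm = Vecₚ.zipWith-comm R.+-comm

  ⊞-identityˡ : ∀ {n} (x : V n) → 𝟎 ⊞ x ≡ x
  ⊞-identityˡ = Vecₚ.zipWith-identityˡ R.+-identityˡ

  ⊞-identityʳ : ∀ {n} (x : V n) → x ⊞ 𝟎 ≡ x
  ⊞-identityʳ = Vecₚ.zipWith-identityʳ R.+-identityʳ

  ⊞-swapʳ : ∀ {n} (x y z : V n) → (x ⊞ y) ⊞ z ≡ (x ⊞ z) ⊞ y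
  ⊞-swapʳ x y z = trans (⊞-assoc x y z) (trans (cong (x ⊞_) (⊞-comm y z)) (sym (⊞-assoc x z y)))

  ·-distribʳ : ∀ {n} c d (x : V n) → (c +F d) · x ≡ c · x ⊞ d · x
  ·-distribʳ c d []      = refl
  ·-distribʳ c d (a ∷ x) = cong₂ _∷_ (R.distribʳ a c d) (·-distribʳ c d x)

  ·-distribˡ : ∀ {n} c (x y : V n) → c · (x ⊞ y) ≡ c · x ⊞ c · y
  ·-distribˡ c []      []      = refl
  ·-distribˡ c (a ∷ x) (b ∷ y) = cong₂ _∷_ (R.distribˡ c a b) (·-distribˡ c x y)

  ·-assoc : ∀ {n} c d (x : V n) → c · (d · x) ≡ (c *F d) · x
  ·-assoc c d x = trans (sym (Vecₚ.map-∘ (c *F_) (d *F_) x)) (Vecₚ.map-cong (λ a → sym (R.*-assoc c d a)) x)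

  1·x≡x : ∀ {n} (x : V n) → 1# · x ≡ x
  1·x≡x x = trans (Vecₚ.map-cong R.*-identityˡ x) (Vecₚ.map-id x)

  0·x≡𝟎 : ∀ {n} (x : V n) → 0# · x ≡ 𝟎
  0·x≡𝟎 []      = refl
  0·x≡𝟎 (a ∷ x) = cong₂ _∷_ (R.zeroˡ a) (0·x≡𝟎 x)

  c·𝟎≡𝟎 : ∀ {n} c → c · 𝟎 {n} ≡ 𝟎
  c·𝟎≡𝟎 {zero}  c = refl
  c·𝟎≡𝟎 {suc n} c = cong₂ _∷_ (R.zeroʳ c) (c·𝟎≡𝟎 c)

  shift-0 : ∀ {n} (x e : V n) → x ⊞ 0# · e ≡ x
  shift-0 x e = trans (cong (x ⊞_) (0·x≡𝟎 e)) (⊞-identityʳ x)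

  shift-shift : ∀ {n} (x e : V n) c d → (x ⊞ c · e) ⊞ d · e ≡ x ⊞ (c +F d) · e
  shift-shift x e c d = trans (⊞-assoc x (c · e) (d · e)) (cong (x ⊞_) (sym (·-distribʳ c d e)))

  shift-inverse : ∀ {n} (x e : V n) c → (x ⊞ c · e) ⊞ (-F c) · e ≡ x
  shift-inverse x e c = trans (shift-shift x e c (-F c))
    (trans (cong (λ d → x ⊞ d · e) (R.-‿inverseʳ c)) (shift-0 x e))

  vecs-complete : ∀ {n} (v : V n) → v ∈ vecs F n
  vecs-complete []      = here refl
  vecs-complete (a ∷ v) = ∈-concatMap⁺ (λ a → map (a ∷_) (vecs F _)) {xs = elements}
    (lose (elements-complete a) (∈-map⁺ (a ∷_) (vecs-complete v)))

  ∃V? : ∀ {n} (P : V n → Bool) → Dec (∃ λ v → P v ≡ true)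
  ∃V? P with Any.any? (λ v → P v Data.Bool.≟ true) (vecs F _)
  ... | yes p = let v , _ , q = find p in yes (v , q)
  ... | no np = no λ (v , q) → np (lose (vecs-complete v) q)

  ∃F? : (P : Carrier → Bool) → Dec (∃ λ c → P c ≡ true)
  ∃F? P = map′ (λ p → let v , _ , q = find p in v , q) (λ (v , q) → lose (elements-complete v) q)
               (Any.any? (λ c → P c Data.Bool.≟ true) elements)

  _∋_ : ∀ {n} → (V n → Bool) → V n → Set
  P ∋ x = P x ≡ true

  _⊑_ : ∀ {n} → (V n → Bool) → (V n → Bool) → Set
  P ⊑ Q = ∀ {x} → P ∋ x → Q ∋ x

  record Subspace {n} (P : V n → Bool) : Set where
    field
      ∋-𝟎 : P ∋ 𝟎
      ∋-⊞ : ∀ {x y} → P ∋ x → P ∋ y → P ∋ x ⊞ y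
      ∋-· : ∀ c {x} → P ∋ x → P ∋ c · x

    ∋-shift : ∀ c {x e} → P ∋ x → P ∋ e → P ∋ x ⊞ c · e
    ∋-shift c p q = ∋-⊞ p (∋-· c q)

    ∋-unshift : ∀ c {x e} → P ∋ x ⊞ c · e → P ∋ e → P ∋ x
    ∋-unshift c {x} {e} p q = subst (P ∋_) (shift-inverse x e c) (∋-shift (-F c) p q)

    ∋-line : ∀ {c e} → c ≢ 0# → P ∋ c · e → P ∋ e
    ∋-line {c} {e} c≢0 p with inverse c c≢0
    ... | c⁻¹ , inv = subst (P ∋_)
      (trans (·-assoc c⁻¹ c e) (trans (cong (_· e) (trans (R.*-comm c⁻¹ c) inv)) (1·x≡x e)))
      (∋-· c⁻¹ p)

    ∋-residue : ∀ {c x e} → c ≢ 0# → P ∋ x → P ∋ x ⊞ c · e → P ∋ e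
    ∋-residue {c} {x} {e} c≢0 p q = ∋-line c≢0 (subst (P ∋_) eq (∋-shift (-F 1#) q p))
      where
      open ≡-Reasoning
      eq : (x ⊞ c · e) ⊞ (-F 1#) · x ≡ c · e
      eq = begin
        (x ⊞ c · e) ⊞ (-F 1#) · x        ≡⟨ cong (λ y → y ⊞ (-F 1#) · x) (⊞-comm x (c · e)) ⟩
        (c · e ⊞ x) ⊞ (-F 1#) · x        ≡⟨ cong (λ y → (c · e ⊞ y) ⊞ (-F 1#) · x) (1·x≡x x) ⟨
        (c · e ⊞ 1# · x) ⊞ (-F 1#) · x   ≡⟨ shift-inverse (c · e) x 1# ⟩
        c · e                            ∎

  open Subspace public

  -- The intersection with the hyperplane of first coordinate zero, seen one dimension lower. A
  -- vector with head `1#`, if there is one, accounts for everything outside it; inductions on `n`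
  -- follow this Gaussian elimination.
  tail : ∀ {n} → (V (suc n) → Bool) → V n → Bool
  tail P y = P (0# ∷ y)

  tail-subspace : ∀ {n} {P : V (suc n) → Bool} → Subspace P → Subspace (tail P)
  tail-subspace {P = P} s = record
    { ∋-𝟎 = ∋-𝟎 s
    ; ∋-⊞ = λ p q → subst (λ c → P ∋ c ∷ _) (R.+-identityˡ 0#) (∋-⊞ s p q)
    ; ∋-· = λ c p → subst (λ d → P ∋ d ∷ _) (R.zeroʳ c) (∋-· s c p)
    }

  Pivot : ∀ {n} → (V (suc n) → Bool) → Set
  Pivot P = ∃ λ v → P ∋ 1# ∷ v

  pivot? : ∀ {n} (P : V (suc n) → Bool) → Dec (Pivot P)
  pivot? P = ∃V? (λ v → P (1# ∷ v))

  clear-head : ∀ {n} c (y v : V n) → (c ∷ y) ⊞ (-F c) · (1# ∷ v) ≡ 0# ∷ (y ⊞ (-F c) · v)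
  clear-head c y v = cong (_∷ (y ⊞ (-F c) · v)) (trans (cong (c +F_) (R.*-identityʳ (-F c))) (R.-‿inverseʳ c))

  ∋-clear : ∀ {n} {P : V (suc n) → Bool} → Subspace P → ∀ {v c y} → P ∋ 1# ∷ v →
            P ∋ c ∷ y → tail P ∋ y ⊞ (-F c) · v
  ∋-clear {P = P} s {v} {c} {y} p q = subst (P ∋_) (clear-head c y v) (∋-shift s (-F c) q p)

  ∋-unclear : ∀ {n} {P : V (suc n) → Bool} → Subspace P → ∀ {v c y} → P ∋ 1# ∷ v →
              tail P ∋ y ⊞ (-F c) · v → P ∋ c ∷ y
  ∋-unclear {P = P} s {v} {c} {y} p q = ∋-unshift s (-F c) (subst (P ∋_) (sym (clear-head c y v)) q) p

  normalise-head : ∀ {n} {P : V (suc n) → Bool} → Subspace P → ∀ {c y} → c ≢ 0# → P ∋ c ∷ y → Pivot P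
  normalise-head {P = P} s {c} {y} c≢0 p with inverse c c≢0
  ... | c⁻¹ , inv = c⁻¹ · y , subst (λ d → P ∋ d ∷ c⁻¹ · y) (trans (R.*-comm c⁻¹ c) inv) (∋-· s c⁻¹ p)

  no-pivot : ∀ {n} {P : V (suc n) → Bool} → Subspace P → ¬ Pivot P → ∀ {c y} → P ∋ c ∷ y → c ≡ 0#
  no-pivot s np {c} p with c ≟F 0#
  ... | yes c≡0 = c≡0
  ... | no  c≢0 = contradiction (normalise-head s c≢0 p) np

  -- Dimension counts the pivots of a reduced echelon basis.
  dim : ∀ {n} → (V n → Bool) → ℕ
  dim {zero}  P = 0
  dim {suc n} P = bit (does (pivot? P)) + dim (tail P)

  dim-mono : ∀ {n} (P Q : V n → Bool) → P ⊑ Q → dim P ≤ dim Q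
  dim-mono {zero}  P Q P⊑Q = z≤n
  dim-mono {suc n} P Q P⊑Q with pivot? P | pivot? Q
  ... | yes _       | yes _ = s≤s (dim-mono (tail P) (tail Q) P⊑Q)
  ... | yes (v , p) | no np = contradiction (v , P⊑Q p) np
  ... | no _        | yes _ = m≤n⇒m≤1+n (dim-mono (tail P) (tail Q) P⊑Q)
  ... | no _        | no _  = dim-mono (tail P) (tail Q) P⊑Q

  -- The bound on dimensions leaves no coordinate in which `Q` has a pivot and `P` has none. A
  -- vector of `Q` can therefore be cleared with pivots of `P` alone.
  dim-≤⇒⊒ : ∀ {n} {P Q : V n → Bool} → Subspace P → Subspace Q → P ⊑ Q → dim Q ≤ dim P → Q ⊑ P
  dim-≤⇒⊒ {zero} sP sQ P⊑Q _ {[]} _ = ∋-𝟎 sP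
  dim-≤⇒⊒ {suc n} {P} {Q} sP sQ P⊑Q le {c ∷ y} q with pivot? P | pivot? Q
  ... | yes (v , p) | yes _ = ∋-unclear sP p
          (dim-≤⇒⊒ (tail-subspace sP) (tail-subspace sQ) P⊑Q (≤-pred le) (∋-clear sQ (P⊑Q p) q))
  ... | yes (v , p) | no np = contradiction (v , P⊑Q p) np
  ... | no _        | yes _ = contradiction (≤-trans le (dim-mono (tail P) (tail Q) P⊑Q)) 1+n≰n
  ... | no _        | no np with no-pivot sQ np q
  ...   | refl = dim-≤⇒⊒ (tail-subspace sP) (tail-subspace sQ) P⊑Q le q

  dim-full : ∀ {n} {P : V n → Bool} → (∀ x → P ∋ x) → dim P ≡ n
  dim-full {zero} _ = refl
  dim-full {suc n} {P} full with pivot? P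
  ... | yes _ = cong suc (dim-full (λ y → full (0# ∷ y)))
  ... | no np = contradiction (𝟎 , full _) np

  dim-trivial : ∀ {n} {P : V n → Bool} → (∀ {x} → P ∋ x → x ≡ 𝟎) → dim P ≡ 0
  dim-trivial {zero} _ = refl
  dim-trivial {suc n} {P} triv with pivot? P
  ... | yes (v , p) = contradiction (sym (cong Vec.head (triv p))) 0≢1
  ... | no _ = dim-trivial {P = tail P} (λ p → cong Vec.tail (triv p))

  record Extends {n} (P Q : V n → Bool) (e : V n) : Set where
    field
      sub       : P ⊑ Q
      new       : ¬ (P ∋ e)
      old       : Q ∋ e
      generates : ∀ {x} → Q ∋ x → ∃ λ c → P ∋ x ⊞ c · e

  -- The cases locate the new pivot. If `P` has a pivot in the first coordinate, it clears the head
  -- of `e` and the tails are compared. If it has none and `ε` is zero, `Q` has none either. If `ε`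
  -- is nonzero, `Q` gains its pivot here and the tails coincide.
  dim-extends : ∀ {n} {P Q : V n → Bool} {e} → Subspace P → Subspace Q → Extends P Q e →
                dim Q ≡ suc (dim P)
  dim-extends {zero} {e = []} sP sQ ext = contradiction (∋-𝟎 sP) (Extends.new ext)
  dim-extends {suc n} {P} {Q} {ε ∷ e} sP sQ ext with pivot? P | pivot? Q
  ... | yes (v , p) | no np = contradiction (v , Extends.sub ext p) np
  ... | yes (v , p) | yes _ = cong suc (dim-extends (tail-subspace sP) (tail-subspace sQ) (record
      { sub = sub
      ; new = λ q → new (∋-unclear sP p q)
      ; old = ∋-clear sQ (sub p) old
      ; generates = gen }))
    where
    open Extends ext
    gen : ∀ {x} → tail Q ∋ x → ∃ λ c → tail P ∋ x ⊞ c · (e ⊞ (-F ε) · v)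
    gen {x} q with generates q
    ... | c , r = c , subst (P ∋_) eq (∋-shift sP (c *F -F ε) r p)
      where
      open ≡-Reasoning
      eq : ((0# ∷ x) ⊞ c · (ε ∷ e)) ⊞ (c *F -F ε) · (1# ∷ v) ≡ 0# ∷ (x ⊞ c · (e ⊞ (-F ε) · v))
      eq = begin
        ((0# ∷ x) ⊞ c · (ε ∷ e)) ⊞ (c *F -F ε) · (1# ∷ v)
          ≡⟨ ⊞-assoc _ _ _ ⟩
        (0# ∷ x) ⊞ (c · (ε ∷ e) ⊞ (c *F -F ε) · (1# ∷ v))
          ≡⟨ cong (λ z → (0# ∷ x) ⊞ (c · (ε ∷ e) ⊞ z)) (·-assoc c (-F ε) (1# ∷ v)) ⟨
        (0# ∷ x) ⊞ (c · (ε ∷ e) ⊞ c · (-F ε) · (1# ∷ v))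
          ≡⟨ cong ((0# ∷ x) ⊞_) (·-distribˡ c (ε ∷ e) _) ⟨
        (0# ∷ x) ⊞ c · ((ε ∷ e) ⊞ (-F ε) · (1# ∷ v))
          ≡⟨ cong (λ z → (0# ∷ x) ⊞ c · z) (clear-head ε e v) ⟩
        (0# ∷ x) ⊞ c · (0# ∷ (e ⊞ (-F ε) · v))
          ≡⟨ cong (_∷ (x ⊞ c · (e ⊞ (-F ε) · v))) (trans (cong (0# +F_) (R.zeroʳ c)) (R.+-identityˡ 0#)) ⟩
        0# ∷ (x ⊞ c · (e ⊞ (-F ε) · v)) ∎
  ... | no npP | Q? with ε ≟F 0#
  ...   | yes refl with Q?
  ...     | yes (w , q) = contradiction pivotP npP
    where
    pivotP : Pivot P
    pivotP with Extends.generates ext q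
    ... | c , r = w ⊞ c · e , subst (λ d → P ∋ d ∷ w ⊞ c · e) (trans (cong (1# +F_) (R.zeroʳ c)) (R.+-identityʳ 1#)) r
  ...     | no _ = dim-extends (tail-subspace sP) (tail-subspace sQ) (record
      { sub = sub ; new = new ; old = old ; generates = gen })
    where
    open Extends ext
    gen : ∀ {x} → tail Q ∋ x → ∃ λ c → tail P ∋ x ⊞ c · e
    gen {x} q with generates q
    ... | c , r = c , subst (λ d → P ∋ d ∷ _) (trans (cong (0# +F_) (R.zeroʳ c)) (R.+-identityʳ 0#)) r
  dim-extends {suc n} {P} {Q} {ε ∷ e} sP sQ ext | no npP | Q? | no ε≢0 with Q?
  ... | no npQ = contradiction (normalise-head sQ ε≢0 (Extends.old ext)) npQ
  ... | yes _  = cong suc (≤-antisym (dim-mono (tail Q) (tail P) back) (dim-mono (tail P) (tail Q) (Extends.sub ext)))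
    where
    back : tail Q ⊑ tail P
    back {z} q with Extends.generates ext q
    ... | c , r with *F-cancel-0 ε≢0 (trans (sym (R.+-identityˡ (c *F ε))) (no-pivot sP npP r))
    ...   | refl = subst (P ∋_) (shift-0 (0# ∷ z) (ε ∷ e)) r

  -- The span of `P` and `e`, tested by a search over scalars alone: some shift of `x` along `e`
  -- must fall into `P`.
  adjoin : ∀ {n} → V n → (V n → Bool) → V n → Bool
  adjoin e P x = does (∃F? (λ c → P (x ⊞ c · e)))

  module _ {n : ℕ} (e : V n) (P : V n → Bool) where

    adjoin⁺ : ∀ {x} c → P ∋ x ⊞ c · e → adjoin e P ∋ x
    adjoin⁺ {x} c p = dec-true (∃F? (λ c → P (x ⊞ c · e))) (c , p)

    adjoin⁻ : ∀ {x} → adjoin e P ∋ x → ∃ λ c → P ∋ x ⊞ c · e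
    adjoin⁻ {x} = does-elim (∃F? (λ c → P (x ⊞ c · e)))

    adjoin-⊒ : P ⊑ adjoin e P
    adjoin-⊒ {x} p = adjoin⁺ 0# (subst (P ∋_) (sym (shift-0 x e)) p)

  module _ {n : ℕ} {e : V n} {P : V n → Bool} (s : Subspace P) where

    adjoin-subspace : Subspace (adjoin e P)
    adjoin-subspace = record
      { ∋-𝟎 = adjoin-⊒ e P (∋-𝟎 s)
      ; ∋-⊞ = λ {x} {y} p q → let c , p′ = adjoin⁻ e P p ; d , q′ = adjoin⁻ e P q in
               adjoin⁺ e P (c +F d) (subst (P ∋_) (eq⊞ x y c d) (∋-⊞ s p′ q′))
      ; ∋-· = λ a {x} p → let c , p′ = adjoin⁻ e P p in
               adjoin⁺ e P (a *F c) (subst (P ∋_) (trans (·-distribˡ a x (c · e)) (cong (a · x ⊞_) (·-assoc a c e))) (∋-· s a p′))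
      }
      where
      open ≡-Reasoning
      eq⊞ : ∀ x y c d → (x ⊞ c · e) ⊞ (y ⊞ d · e) ≡ (x ⊞ y) ⊞ (c +F d) · e
      eq⊞ x y c d = begin
        (x ⊞ c · e) ⊞ (y ⊞ d · e)  ≡⟨ ⊞-assoc (x ⊞ c · e) y (d · e) ⟨
        ((x ⊞ c · e) ⊞ y) ⊞ d · e  ≡⟨ cong (_⊞ d · e) (⊞-swapʳ x (c · e) y) ⟩
        ((x ⊞ y) ⊞ c · e) ⊞ d · e  ≡⟨ shift-shift (x ⊞ y) e c d ⟩
        (x ⊞ y) ⊞ (c +F d) · e     ∎

    adjoin-∋ : adjoin e P ∋ e
    adjoin-∋ = adjoin⁺ e P (-F 1#) (subst (P ∋_) (sym eq) (∋-𝟎 s))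
      where
      eq : e ⊞ (-F 1#) · e ≡ 𝟎
      eq = trans (cong (_⊞ (-F 1#) · e) (sym (trans (⊞-identityˡ (1# · e)) (1·x≡x e)))) (shift-inverse 𝟎 e 1#)

    adjoin-least : ∀ {Q : V n → Bool} → Subspace Q → P ⊑ Q → Q ∋ e → adjoin e P ⊑ Q
    adjoin-least sQ P⊑Q q p = let c , p′ = adjoin⁻ e P p in ∋-unshift sQ c (P⊑Q p′) q

    adjoin-extends : ¬ (P ∋ e) → Extends P (adjoin e P) e
    adjoin-extends new = record { sub = adjoin-⊒ e P ; new = new ; old = adjoin-∋ ; generates = adjoin⁻ e P }

  dim-adjoin : ∀ {n} {P : V n → Bool} {e} → Subspace P → ¬ (P ∋ e) → dim (adjoin e P) ≡ suc (dim P)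
  dim-adjoin s new = dim-extends s (adjoin-subspace s) (adjoin-extends s new)

  lincomb-0 : ∀ {n d} (vs : Vec (V n) d) → lincomb F (Vec.replicate d 0#) vs ≡ 𝟎
  lincomb-0 []       = refl
  lincomb-0 (v ∷ vs) = trans (cong₂ _⊞_ (0·x≡𝟎 v) (lincomb-0 vs)) (⊞-identityˡ 𝟎)

  -- Here `vs` is a basis of `Q` modulo `P`. The base space is kept general so that the first vector
  -- can be absorbed into it by `adjoin`; starting from the zero space, this identifies the
  -- dimension given by a basis with the count of pivots.
  dim-basis-over : ∀ {n d} {P Q : V n → Bool} (vs : Vec (V n) d) → Subspace P → Subspace Q → P ⊑ Q →
    (∀ cs → Q ∋ lincomb F cs vs) →
    (∀ cs → P ∋ lincomb F cs vs → cs ≡ Vec.replicate d 0#) →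
    (∀ {w} → Q ∋ w → ∃₂ λ cs p → P ∋ p × lincomb F cs vs ⊞ p ≡ w) →
    dim Q ≡ d + dim P
  dim-basis-over {P = P} {Q} [] sP sQ P⊑Q _ _ span = ≤-antisym (dim-mono Q P back) (dim-mono P Q P⊑Q)
    where
    back : Q ⊑ P
    back q with span q
    ... | [] , p , p∈ , refl = subst (P ∋_) (sym (⊞-identityˡ p)) p∈
  dim-basis-over {d = suc d} {P} {Q} (v ∷ vs) sP sQ P⊑Q comb ind span =
    trans (dim-basis-over {P = adjoin v P} vs (adjoin-subspace sP) sQ
             (adjoin-least sP sQ P⊑Q (subst (Q ∋_) v-comb (comb (1# ∷ Vec.replicate d 0#))))
             (λ cs → subst (Q ∋_) (trans (cong (_⊞ lincomb F cs vs) (0·x≡𝟎 v)) (⊞-identityˡ _)) (comb (0# ∷ cs)))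
             ind′ span′)
          (trans (cong (d +_) (dim-adjoin sP v∉)) (+-suc d (dim P)))
    where
    v-comb : lincomb F (1# ∷ Vec.replicate d 0#) (v ∷ vs) ≡ v
    v-comb = trans (cong₂ _⊞_ (1·x≡x v) (lincomb-0 vs)) (⊞-identityʳ v)
    v∉ : ¬ (P ∋ v)
    v∉ p = 0≢1 (sym (cong Vec.head (ind (1# ∷ Vec.replicate d 0#) (subst (P ∋_) (sym v-comb) p))))
    ind′ : ∀ cs → adjoin v P ∋ lincomb F cs vs → cs ≡ Vec.replicate d 0#
    ind′ cs p with adjoin⁻ v P p
    ... | c , p′ = cong Vec.tail (ind (c ∷ cs) (subst (P ∋_) (⊞-comm (lincomb F cs vs) (c · v)) p′))
    span′ : ∀ {w} → Q ∋ w → ∃₂ λ cs p → adjoin v P ∋ p × lincomb F cs vs ⊞ p ≡ w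
    span′ q with span q
    ... | c ∷ cs , p , p∈ , refl = cs , c · v ⊞ p ,
      ∋-⊞ (adjoin-subspace sP) (∋-· (adjoin-subspace sP) c (adjoin-∋ sP)) (adjoin-⊒ v P p∈) ,
      trans (sym (⊞-assoc (lincomb F cs vs) (c · v) p)) (cong (_⊞ p) (⊞-comm (lincomb F cs vs) (c · v)))

  record Linear {n} (φ : V n → Carrier) : Set where
    field
      φ-⊞ : ∀ x y → φ (x ⊞ y) ≡ φ x +F φ y
      φ-· : ∀ c x → φ (c · x) ≡ c *F φ x

    φ-shift : ∀ x c e → φ (x ⊞ c · e) ≡ φ x +F c *F φ e
    φ-shift x c e = trans (φ-⊞ x (c · e)) (cong (φ x +F_) (φ-· c e))

  open Linear public

  -- A pivot `1# ∷ v` of `P` must be killed, so the functional for the tails is applied to the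
  -- cleared vector `y − c v`. Without a pivot all heads in `P` vanish: if `ε` is zero the
  -- functional ignores the head, and otherwise the first coordinate divided by `ε` does.
  separate : ∀ {n} {P : V n → Bool} {e} → Subspace P → ¬ (P ∋ e) →
             ∃ λ φ → Linear φ × (∀ {x} → P ∋ x → φ x ≡ 0#) × φ e ≡ 1#
  separate {zero} {e = []} s e∉ = contradiction (∋-𝟎 s) e∉
  separate {suc n} {P} {ε ∷ e} s e∉ with pivot? P
  ... | yes (v , p) = φ , lin , (λ { {c ∷ y} q → trans (φ-clear c y) (ψ0 (∋-clear s p q)) }) , trans (φ-clear ε e) ψe
    where
    open ≡-Reasoning
    sep = separate (tail-subspace s) (λ q → e∉ (∋-unclear s p q))
    ψ = proj₁ sep
    linψ = proj₁ (proj₂ sep)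
    ψ0 = proj₁ (proj₂ (proj₂ sep))
    ψe = proj₂ (proj₂ (proj₂ sep))
    k = -F ψ v
    φ : V (suc n) → Carrier
    φ (c ∷ y) = ψ y +F c *F k
    φ-clear : ∀ c y → φ (c ∷ y) ≡ ψ (y ⊞ (-F c) · v)
    φ-clear c y = sym (trans (φ-shift linψ y (-F c) v)
      (cong (ψ y +F_) (trans (sym (R.-‿distribˡ-* c (ψ v))) (R.-‿distribʳ-* c (ψ v)))))
    +F-interchange : ∀ a b c d → (a +F b) +F (c +F d) ≡ (a +F c) +F (b +F d)
    +F-interchange a b c d = begin
      (a +F b) +F (c +F d) ≡⟨ R.+-assoc a b (c +F d) ⟩
      a +F (b +F (c +F d)) ≡⟨ cong (a +F_) (R.+-assoc b c d) ⟨
      a +F ((b +F c) +F d) ≡⟨ cong (λ x → a +F (x +F d)) (R.+-comm b c) ⟩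
      a +F ((c +F b) +F d) ≡⟨ cong (a +F_) (R.+-assoc c b d) ⟩
      a +F (c +F (b +F d)) ≡⟨ R.+-assoc a c (b +F d) ⟨
      (a +F c) +F (b +F d) ∎
    lin : Linear φ
    lin = record
      { φ-⊞ = λ { (c ∷ y) (d ∷ z) → trans (cong₂ _+F_ (φ-⊞ linψ y z) (R.distribʳ k c d)) (+F-interchange _ _ _ _) }
      ; φ-· = λ { a (c ∷ y) → trans (cong₂ _+F_ (φ-· linψ a y) (R.*-assoc a c k)) (sym (R.distribˡ a _ _)) }
      }
  ... | no np with ε ≟F 0#
  ...   | yes refl = φ , lin , (λ { {c ∷ y} q → kill c y q }) , ψe
    where
    sep = separate (tail-subspace s) e∉
    ψ = proj₁ sep
    linψ = proj₁ (proj₂ sep)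
    ψe = proj₂ (proj₂ (proj₂ sep))
    φ : V (suc n) → Carrier
    φ (c ∷ y) = ψ y
    kill : ∀ c y → P ∋ c ∷ y → ψ y ≡ 0#
    kill c y q with no-pivot s np q
    ... | refl = proj₁ (proj₂ (proj₂ sep)) q
    lin : Linear φ
    lin = record { φ-⊞ = λ { (c ∷ y) (d ∷ z) → φ-⊞ linψ y z } ; φ-· = λ { a (c ∷ y) → φ-· linψ a y } }
  ...   | no ε≢0 with inverse ε ε≢0
  ...     | ε⁻¹ , inv = φ , lin , (λ { {c ∷ y} q → trans (cong (_*F ε⁻¹) (no-pivot s np q)) (R.zeroˡ ε⁻¹) }) , inv
    where
    φ : V (suc n) → Carrier
    φ (c ∷ y) = c *F ε⁻¹
    lin : Linear φ
    lin = record { φ-⊞ = λ { (c ∷ y) (d ∷ z) → R.distribʳ ε⁻¹ c d } ; φ-· = λ { a (c ∷ y) → R.*-assoc a c ε⁻¹ } }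

-- Subspaces as lists of Booleans

module SubspaceLists (F : FiniteField) where

  open LinearAlgebra F public

  vecs-unique : ∀ n → Unique (vecs F n)
  vecs-unique zero    = All.[] ∷ []
  vecs-unique (suc n) = go elements-unique
    where
    go : ∀ {cs} → Unique cs → Unique (concatMap (λ a → map (a ∷_) (vecs F n)) cs)
    go []                      = []
    go {c ∷ cs} (c∉ ∷ u) = ++⁺ (map⁺ (cong Vec.tail) (vecs-unique n)) (go u) disjoint
      where
      disjoint : ∀ {v} → v ∈ map (c ∷_) (vecs F n) × v ∈ concatMap (λ a → map (a ∷_) (vecs F n)) cs → _
      disjoint (p , q) with ∈-map⁻ (c ∷_) p | find (∈-concatMap⁻ (λ a → map (a ∷_) (vecs F n)) {xs = cs} q)
      ... | _ , _ , eq | d , d∈ , r with ∈-map⁻ (d ∷_) r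
      ... | _ , _ , eq′ = All.lookup c∉ d∈ (cong Vec.head (trans (sym eq) eq′))

  memAux-∈ : ∀ {n} {v : V n} us S → memAux F v us S ≡ true → v ∈ us
  memAux-∈ {v = v} (u ∷ us) (b ∷ S) p with b ∧ does (_≟v_ F v u) in eq
  ... | true  = here (does-elim (_≟v_ F v u) (proj₂ (∧-elim {b} eq)))
  ... | false = there (memAux-∈ us S p)

  memAux-here : ∀ {n} {v : V n} us {S} → memAux F v (v ∷ us) (true ∷ S) ≡ true
  memAux-here {v = v} us rewrite dec-true (_≟v_ F v v) refl = refl

  memAux-there : ∀ {n} {v : V n} {u} us b {S} → memAux F v us S ≡ true → memAux F v (u ∷ us) (b ∷ S) ≡ true
  memAux-there {v = v} {u} us b p with b ∧ does (_≟v_ F v u)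
  ... | true  = refl
  ... | false = p

  memAux-uncons : ∀ {n} {v : V n} {u} us b {S} → memAux F v (u ∷ us) (b ∷ S) ≡ true →
                  (v ≡ u × b ≡ true) ⊎ memAux F v us S ≡ true
  memAux-uncons {v = v} {u} us b p with b ∧ does (_≟v_ F v u) in eq
  ... | true  = inj₁ (does-elim (_≟v_ F v u) (proj₂ (∧-elim {b} eq)) , proj₁ (∧-elim {b} eq))
  ... | false = inj₂ p

  memAux-map⁺ : ∀ {n} {v : V n} (P : V n → Bool) {us} → v ∈ us → P ∋ v → memAux F v us (map P us) ≡ true
  memAux-map⁺ P {u ∷ us} (here refl) p rewrite p = memAux-here us
  memAux-map⁺ P {u ∷ us} (there v∈)  p = memAux-there us (P u) (memAux-map⁺ P v∈ p)

  memAux-map⁻ : ∀ {n} {v : V n} (P : V n → Bool) us → memAux F v us (map P us) ≡ true → P ∋ v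
  memAux-map⁻ P (u ∷ us) p with memAux-uncons us (P u) p
  ... | inj₁ (refl , q) = q
  ... | inj₂ q          = memAux-map⁻ P us q

  ⊆ᵇ-sound : ∀ {n} (us : List (V n)) {S S′} → length S ≡ length S′ → ⊆ᵇ F S S′ ≡ true →
             ∀ {v} → memAux F v us S ≡ true → memAux F v us S′ ≡ true
  ⊆ᵇ-sound (u ∷ us) {b ∷ S} {b′ ∷ S′} len le {v} p with memAux-uncons us b p | ∧-elim {not b ∨ b′} le
  ... | inj₁ (refl , refl) | refl , _  = memAux-here us
  ... | inj₂ q             | _    , le′ = memAux-there us b′ (⊆ᵇ-sound us (suc-injective len) le′ q)

  -- Membership only asks for some position of `v` that is marked true. It determines the single
  -- Booleans, and hence `⊆ᵇ`, because no vector is repeated in `us`.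
  ⊆ᵇ-complete : ∀ {n} (us : List (V n)) {S S′} → Unique us → length S ≡ length us → length S′ ≡ length us →
                (∀ {v} → memAux F v us S ≡ true → memAux F v us S′ ≡ true) → ⊆ᵇ F S S′ ≡ true
  ⊆ᵇ-complete [] {[]} {[]} _ _ _ _ = refl
  ⊆ᵇ-complete (u ∷ us) {b ∷ S} {b′ ∷ S′} (u∉ ∷ un) len len′ h =
    ∧-true (head-≤ b refl) (⊆ᵇ-complete us un (suc-injective len) (suc-injective len′) tail-⊆)
    where
    head-≤ : ∀ c → c ≡ b → not c ∨ b′ ≡ true
    head-≤ false _ = refl
    head-≤ true refl with memAux-uncons us b′ (h (memAux-here us))
    ... | inj₁ (_ , q) = q
    ... | inj₂ q       = contradiction refl (All.lookup u∉ (memAux-∈ us S′ q))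
    tail-⊆ : ∀ {v} → memAux F v us S ≡ true → memAux F v us S′ ≡ true
    tail-⊆ p with memAux-uncons us b′ (h (memAux-there us b p))
    ... | inj₁ (refl , _) = contradiction refl (All.lookup u∉ (memAux-∈ us S p))
    ... | inj₂ q          = q

  ⊆ᵇ-antisym : ∀ {S S′} → length S ≡ length S′ → ⊆ᵇ F S S′ ≡ true → ⊆ᵇ F S′ S ≡ true → S ≡ S′
  ⊆ᵇ-antisym {[]}    {[]}      _   _ _ = refl
  ⊆ᵇ-antisym {b ∷ S} {b′ ∷ S′} len p q with ∧-elim {not b ∨ b′} p | ∧-elim {not b′ ∨ b} q
  ... | p₁ , p₂ | q₁ , q₂ = cong₂ _∷_ (bool b b′ p₁ q₁) (⊆ᵇ-antisym (suc-injective len) p₂ q₂)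
    where
    bool : ∀ a b → not a ∨ b ≡ true → not b ∨ a ≡ true → a ≡ b
    bool false false _ _ = refl
    bool true  true  _ _ = refl

  allSubsets-length : ∀ m {S} → S ∈ allSubsets F m → length S ≡ m
  allSubsets-length zero (here refl) = refl
  allSubsets-length (suc m) S∈ with ∈-++⁻ (map (true ∷_) (allSubsets F m)) S∈
  ... | inj₁ p with ∈-map⁻ (true ∷_) p
  ...   | _ , q , refl = cong suc (allSubsets-length m q)
  allSubsets-length (suc m) S∈ | inj₂ p with ∈-map⁻ (false ∷_) p
  ...   | _ , q , refl = cong suc (allSubsets-length m q)

  allSubsets-complete : ∀ S → S ∈ allSubsets F (length S)
  allSubsets-complete []          = here refl
  allSubsets-complete (true  ∷ S) = ∈-++⁺ˡ (∈-map⁺ (true ∷_) (allSubsets-complete S))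
  allSubsets-complete (false ∷ S) = ∈-++⁺ʳ (map (true ∷_) (allSubsets F (length S))) (∈-map⁺ (false ∷_) (allSubsets-complete S))

  allSubsets-unique : ∀ m → Unique (allSubsets F m)
  allSubsets-unique zero    = All.[] ∷ []
  allSubsets-unique (suc m) = ++⁺ (map⁺ ∷-injectiveʳ (allSubsets-unique m)) (map⁺ ∷-injectiveʳ (allSubsets-unique m)) disjoint
    where
    disjoint : ∀ {S} → S ∈ map (true ∷_) (allSubsets F m) × S ∈ map (false ∷_) (allSubsets F m) → _
    disjoint (p , q) with ∈-map⁻ (true ∷_) p | ∈-map⁻ (false ∷_) q
    ... | _ , _ , refl | _ , _ , ()

  allBool⁺ : ∀ {X : Set} {p : X → Bool} xs → (∀ {x} → x ∈ xs → p x ≡ true) → allBool F p xs ≡ true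
  allBool⁺ []       h = refl
  allBool⁺ (x ∷ xs) h = ∧-true (h (here refl)) (allBool⁺ xs (h ∘ there))

  allBool⁻ : ∀ {X : Set} {p : X → Bool} {xs} → allBool F p xs ≡ true → ∀ {x} → x ∈ xs → p x ≡ true
  allBool⁻ {p = p} {x ∷ xs} h (here refl) = proj₁ (∧-elim {p x} h)
  allBool⁻ {p = p} {x ∷ xs} h (there x∈)  = allBool⁻ (proj₂ (∧-elim {p x} h)) x∈

  ⇒ᵇ⁺ : ∀ {a b} → (a ≡ true → b ≡ true) → not a ∨ b ≡ true
  ⇒ᵇ⁺ {false} h = refl
  ⇒ᵇ⁺ {true}  h = h refl

  ⇒ᵇ⁻ : ∀ {a b} → not a ∨ b ≡ true → a ≡ true → b ≡ true
  ⇒ᵇ⁻ h refl = h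

module SubspaceLattice (F : FiniteField) (n : ℕ) where

  open SubspaceLists F public

  ⟦_⟧ :  List Bool → V n → Bool
  ⟦ S ⟧ v = mem F v S

  isSubspace⁻ : ∀ S → isSubspace F n S ≡ true → Subspace ⟦ S ⟧
  isSubspace⁻ S h = record
    { ∋-𝟎 = proj₁ hs
    ; ∋-⊞ = λ {x} {y} p q → ⇒ᵇ⁻ (allBool⁻ (allBool⁻ {xs = vecs F n} (proj₁ (∧-elim (proj₂ hs))) (vecs-complete x)) (vecs-complete y)) (∧-true p q)
    ; ∋-· = λ c {x} p → ⇒ᵇ⁻ (allBool⁻ (allBool⁻ {xs = elements} (proj₂ (∧-elim (proj₂ hs))) (elements-complete c)) (vecs-complete x)) p
    }
    where hs = ∧-elim {mem F (zeroV F n) S} h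

  isSubspace⁺ : ∀ S → Subspace ⟦ S ⟧ → isSubspace F n S ≡ true
  isSubspace⁺ S s = ∧-true (∋-𝟎 s) (∧-true
    (allBool⁺ (vecs F n) λ {x} _ → allBool⁺ (vecs F n) λ {y} _ → ⇒ᵇ⁺ λ h → let p , q = ∧-elim {⟦ S ⟧ x} h in ∋-⊞ s p q)
    (allBool⁺ elements λ {c} _ → allBool⁺ (vecs F n) λ _ → ⇒ᵇ⁺ (∋-· s c)))

  subspaces-unique : Unique (subspaces F n)
  subspaces-unique = filter⁺ (T? ∘ isSubspace F n) (allSubsets-unique (length (vecs F n)))

  ⟦⟧-subspace : ∀ {S} → S ∈ subspaces F n → Subspace ⟦ S ⟧
  ⟦⟧-subspace {S} S∈ = isSubspace⁻ S (proj₂ (∈-filterᵇ⁻ (isSubspace F n) {xs = allSubsets F (length (vecs F n))} S∈))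

  subspaces-length : ∀ {S} → S ∈ subspaces F n → length S ≡ length (vecs F n)
  subspaces-length S∈ = allSubsets-length _ (proj₁ (∈-filterᵇ⁻ (isSubspace F n) {xs = allSubsets F (length (vecs F n))} S∈))

  subspaces-complete : ∀ S → length S ≡ length (vecs F n) → Subspace ⟦ S ⟧ → S ∈ subspaces F n
  subspaces-complete S len s = ∈-filterᵇ⁺ (isSubspace F n)
    (subst (λ m → S ∈ allSubsets F m) len (allSubsets-complete S)) (isSubspace⁺ S s)

  Subspace-resp : ∀ {P Q : V n → Bool} → P ⊑ Q → Q ⊑ P → Subspace P → Subspace Q
  Subspace-resp P⊑Q Q⊑P s = record
    { ∋-𝟎 = P⊑Q (∋-𝟎 s) ; ∋-⊞ = λ p q → P⊑Q (∋-⊞ s (Q⊑P p) (Q⊑P q)) ; ∋-· = λ c p → P⊑Q (∋-· s c (Q⊑P p)) }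

  -- Constructions on subspaces are made with predicates and tabulated afterwards. The tabulated
  -- form is canonical, so subspaces with the same vectors are propositionally equal lists.
  reify :  (V n → Bool) → List Bool
  reify P = map P (vecs F n)

  reify⁺ : ∀ (P : V n → Bool) → P ⊑ ⟦ reify P ⟧
  reify⁺ P {x} = memAux-map⁺ P (vecs-complete x)

  reify⁻ : ∀ (P : V n → Bool) → ⟦ reify P ⟧ ⊑ P
  reify⁻ P = memAux-map⁻ P (vecs F n)

  reify-∈ : ∀ {P : V n → Bool} → Subspace P → reify P ∈ subspaces F n
  reify-∈ {P} s = subspaces-complete (reify P) (length-map P (vecs F n)) (Subspace-resp (reify⁺ P) (reify⁻ P) s)

  dim-reify : ∀ (P : V n → Bool) → dim ⟦ reify P ⟧ ≡ dim P
  dim-reify P = ≤-antisym (dim-mono ⟦ reify P ⟧ P (reify⁻ P)) (dim-mono P ⟦ reify P ⟧ (reify⁺ P))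

  module _ {S S′ : List Bool} (S∈ : S ∈ subspaces F n) (S′∈ : S′ ∈ subspaces F n) where

    ⊆⇒⊑ : ⊆ᵇ F S S′ ≡ true → ⟦ S ⟧ ⊑ ⟦ S′ ⟧
    ⊆⇒⊑ le = ⊆ᵇ-sound (vecs F n) (trans (subspaces-length S∈) (sym (subspaces-length S′∈))) le

    ⊑⇒⊆ : ⟦ S ⟧ ⊑ ⟦ S′ ⟧ → ⊆ᵇ F S S′ ≡ true
    ⊑⇒⊆ le = ⊆ᵇ-complete (vecs F n) (vecs-unique n) (subspaces-length S∈) (subspaces-length S′∈) le

  ⊑-antisym : ∀ {S S′} → S ∈ subspaces F n → S′ ∈ subspaces F n →
              ⟦ S ⟧ ⊑ ⟦ S′ ⟧ → ⟦ S′ ⟧ ⊑ ⟦ S ⟧ → S ≡ S′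
  ⊑-antisym S∈ S′∈ p q = ⊆ᵇ-antisym (trans (subspaces-length S∈) (sym (subspaces-length S′∈)))
    (⊑⇒⊆ S∈ S′∈ p) (⊑⇒⊆ S′∈ S∈ q)

  fullSpace-∋ : ∀ x → ⟦ fullSpace F n ⟧ ∋ x
  fullSpace-∋ x = go (vecs-complete x)
    where
    go : ∀ {us} → x ∈ us → memAux F x us (replicate (length us) true) ≡ true
    go {u ∷ us} (here refl) = memAux-here us
    go {u ∷ us} (there x∈)  = memAux-there us true (go x∈)

  fullSpace-∈ : fullSpace F n ∈ subspaces F n
  fullSpace-∈ = subspaces-complete (fullSpace F n) (length-replicate (length (vecs F n)))
    (record { ∋-𝟎 = fullSpace-∋ 𝟎 ; ∋-⊞ = λ _ _ → fullSpace-∋ _ ; ∋-· = λ _ _ → fullSpace-∋ _ })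

  zeroP : V n → Bool
  zeroP x = does (_≟v_ F x 𝟎)

  zeroP⁻ : ∀ {x} → zeroP ∋ x → x ≡ 𝟎
  zeroP⁻ {x = x} = does-elim (_≟v_ F x 𝟎)

  zeroP-subspace :  Subspace zeroP
  zeroP-subspace = record
    { ∋-𝟎 = dec-true (_≟v_ F (𝟎 {n}) 𝟎) refl
    ; ∋-⊞ = λ {x} {y} p q → dec-true (_≟v_ F (x ⊞ y) 𝟎) (trans (cong₂ _⊞_ (zeroP⁻ p) (zeroP⁻ q)) (⊞-identityˡ 𝟎))
    ; ∋-· = λ c {x} p → dec-true (_≟v_ F (c · x) 𝟎) (trans (cong (c ·_) (zeroP⁻ p)) (c·𝟎≡𝟎 c))
    }

  zeroP-⊑ : ∀ {P : V n → Bool} → Subspace P → zeroP ⊑ P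
  zeroP-⊑ {P = P} s p = subst (P ∋_) (sym (zeroP⁻ p)) (∋-𝟎 s)

  HasDim⇒dim : ∀ {W d} → W ∈ subspaces F n → HasDim F n W d → dim ⟦ W ⟧ ≡ d
  HasDim⇒dim {W} {d} W∈ (basis , basis∈ , ind , span) = trans
    (dim-basis-over basis zeroP-subspace sW (zeroP-⊑ sW) comb (λ cs p → ind cs (zeroP⁻ p))
      λ {w} q → let cs , eq = span w q in cs , 𝟎 , ∋-𝟎 zeroP-subspace , trans (⊞-identityʳ _) eq)
    (trans (cong (d +_) (dim-trivial zeroP⁻)) (+-identityʳ d))
    where
    sW = ⟦⟧-subspace W∈
    comb : ∀ cs → ⟦ W ⟧ ∋ lincomb F cs basis
    comb = go basis∈
      where
      go : ∀ {k} {vs : Vec (V n) k} → Allᵛ (λ v → mem F v W ≡ true) vs → ∀ cs → ⟦ W ⟧ ∋ lincomb F cs vs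
      go []       []       = ∋-𝟎 sW
      go (p ∷ ps) (c ∷ cs) = ∋-⊞ sW (∋-· sW c p) (go ps cs)

-- Nim-sums over intervals of the subspace lattice

module IntervalSums (F : FiniteField) (n : ℕ) where

  open SubspaceLattice F n public

  infix 4 _≤ᴸ_ _≟ᴸ_

  L : List (List Bool)
  L = subspaces F n

  _≤ᴸ_ : List Bool → List Bool → Bool
  _≤ᴸ_ = ⊆ᵇ F

  _≟ᴸ_ : DecidableEquality (List Bool)
  _≟ᴸ_ = Data.List.Properties.≡-dec Data.Bool._≟_

  Dim : List Bool → ℕ
  Dim S = dim ⟦ S ⟧

  ⊑-or-missing : ∀ S S′ → ⟦ S ⟧ ⊑ ⟦ S′ ⟧ ⊎ ∃ λ x → ⟦ S ⟧ ∋ x × ¬ (⟦ S′ ⟧ ∋ x)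
  ⊑-or-missing S S′ with ∃V? (λ x → ⟦ S ⟧ x ∧ not (⟦ S′ ⟧ x))
  ... | yes (x , p) = let q , r = ∧-elim {⟦ S ⟧ x} p in inj₂ (x , q , not-elim r)
  ... | no none = inj₁ λ {x} p → decidable-stable (⟦ S′ ⟧ x Data.Bool.≟ true)
                    λ np → none (x , ∧-true p (not-true np))

  extend : V n → List Bool → List Bool
  extend e S = reify (adjoin e ⟦ S ⟧)

  module _ {e : V n} {S : List Bool} (S∈ : S ∈ L) where

    private s = ⟦⟧-subspace S∈

    extend-∈ : extend e S ∈ L
    extend-∈ = reify-∈ (adjoin-subspace s)

    extend⁺ : ∀ {x} c → ⟦ S ⟧ ∋ x ⊞ c · e → ⟦ extend e S ⟧ ∋ x
    extend⁺ c p = reify⁺ (adjoin e ⟦ S ⟧) (adjoin⁺ e ⟦ S ⟧ c p)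

    extend⁻ : ∀ {x} → ⟦ extend e S ⟧ ∋ x → ∃ λ c → ⟦ S ⟧ ∋ x ⊞ c · e
    extend⁻ p = adjoin⁻ e ⟦ S ⟧ (reify⁻ (adjoin e ⟦ S ⟧) p)

    extend-⊒ : ⟦ S ⟧ ⊑ ⟦ extend e S ⟧
    extend-⊒ p = reify⁺ (adjoin e ⟦ S ⟧) (adjoin-⊒ e ⟦ S ⟧ p)

    extend-∋ : ⟦ extend e S ⟧ ∋ e
    extend-∋ = reify⁺ (adjoin e ⟦ S ⟧) (adjoin-∋ s)

    extend-least : ∀ {S′} → S′ ∈ L → ⟦ S ⟧ ⊑ ⟦ S′ ⟧ → ⟦ S′ ⟧ ∋ e → ⟦ extend e S ⟧ ⊑ ⟦ S′ ⟧
    extend-least S′∈ le q p = adjoin-least s (⟦⟧-subspace S′∈) le q (reify⁻ (adjoin e ⟦ S ⟧) p)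

    Dim-extend : ¬ (⟦ S ⟧ ∋ e) → Dim (extend e S) ≡ suc (Dim S)
    Dim-extend new = trans (dim-reify (adjoin e ⟦ S ⟧)) (dim-adjoin s new)

  between : List Bool → List Bool → List Bool → Bool
  between a W t = (a ≤ᴸ t) ∧ (t ≤ᴸ W)

  between⁺ : ∀ {a W t} → a ∈ L → W ∈ L → t ∈ L → ⟦ a ⟧ ⊑ ⟦ t ⟧ → ⟦ t ⟧ ⊑ ⟦ W ⟧ → between a W t ≡ true
  between⁺ a∈ W∈ t∈ p q = ∧-true (⊑⇒⊆ a∈ t∈ p) (⊑⇒⊆ t∈ W∈ q)

  between⁻ : ∀ {a W t} → a ∈ L → W ∈ L → t ∈ L → between a W t ≡ true → ⟦ a ⟧ ⊑ ⟦ t ⟧ × ⟦ t ⟧ ⊑ ⟦ W ⟧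
  between⁻ {a} {W} {t} a∈ W∈ t∈ h = let p , q = ∧-elim {a ≤ᴸ t} h in ⊆⇒⊑ a∈ t∈ p , ⊆⇒⊑ t∈ W∈ q

  intervalSum : (List Bool → ℕ) → List Bool → List Bool → ℕ
  intervalSum g a W = ⨁ L (λ t → guard (between a W t) (g t))

  -- t is a hyperplane of u that contains a and is complementary to the line of e
  complement : List Bool → V n → List Bool → List Bool → Bool
  complement a e u t = (a ≤ᴸ t) ∧ not (mem F e t) ∧ does (extend e t ≟ᴸ u)

  module _ {a : List Bool} {e : V n} {u t : List Bool} (a∈ : a ∈ L) (t∈ : t ∈ L) where

    complement⁺ : ⟦ a ⟧ ⊑ ⟦ t ⟧ → ¬ (⟦ t ⟧ ∋ e) → extend e t ≡ u → complement a e u t ≡ true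
    complement⁺ p q r = ∧-true (⊑⇒⊆ a∈ t∈ p) (∧-true (not-true q) (dec-true (extend e t ≟ᴸ u) r))

    complement⁻ : complement a e u t ≡ true → ⟦ a ⟧ ⊑ ⟦ t ⟧ × ¬ (⟦ t ⟧ ∋ e) × extend e t ≡ u
    complement⁻ h with ∧-elim {a ≤ᴸ t} h
    ... | p , h′ with ∧-elim {not (mem F e t)} h′
    ... | q , r = ⊆⇒⊑ a∈ t∈ p , not-elim q , does-elim (extend e t ≟ᴸ u) r

  -- Group the members t of [a,W] by the join of t with the line of e.
  intervalSum-split : ∀ {a W e} (g : List Bool → ℕ) → a ∈ L → W ∈ L → ⟦ a ⟧ ⊑ ⟦ W ⟧ → ⟦ W ⟧ ∋ e →
    intervalSum g a W ≡
    ⨁ L (λ u → guard (between (extend e a) W u) (g u ⊕ ⨁ L (λ t → guard (complement a e u t) (g t))))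
  intervalSum-split {a} {W} {e} g a∈ W∈ a⊑W e∈W = begin
    ⨁ L (λ t → guard (between a W t) (g t))
      ≡⟨ ⨁-cong L (λ {t} _ → guard-split (between a W t) (mem F e t) (g t)) ⟩
    ⨁ L (λ t → guard (between a W t ∧ mem F e t) (g t) ⊕ guard (between a W t ∧ not (mem F e t)) (g t))
      ≡⟨ ⨁-⊕ L _ _ ⟩
    ⨁ L (λ t → guard (between a W t ∧ mem F e t) (g t)) ⊕ ⨁ L (λ t → guard (between a W t ∧ not (mem F e t)) (g t))
      ≡⟨ cong₂ _⊕_ (⨁-cong L (λ {t} t∈ → cong (λ b → guard b (g t)) (containing t∈)))
                   (trans (⨁-cong L avoiding) (⨁-swap L L _)) ⟩
    ⨁ L (λ u → guard (between p W u) (g u)) ⊕ ⨁ L (λ u → ⨁ L (λ t → guard (between p W u ∧ complement a e u t) (g t)))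
      ≡⟨ ⨁-⊕ L _ _ ⟨
    ⨁ L (λ u → guard (between p W u) (g u) ⊕ ⨁ L (λ t → guard (between p W u ∧ complement a e u t) (g t)))
      ≡⟨ ⨁-cong L (λ {u} _ → collect u) ⟩
    ⨁ L (λ u → guard (between p W u) (g u ⊕ ⨁ L (λ t → guard (complement a e u t) (g t)))) ∎
    where
    open ≡-Reasoning
    p = extend e a
    p∈ = extend-∈ {e} a∈
    containing : ∀ {t} → t ∈ L → between a W t ∧ mem F e t ≡ between p W t
    containing {t} t∈ = ≡true-ext
      (λ h → let i , e∈t = ∧-elim {between a W t} h ; a⊑t , t⊑W = between⁻ a∈ W∈ t∈ i in
             between⁺ p∈ W∈ t∈ (extend-least a∈ t∈ a⊑t e∈t) t⊑W)
      (λ h → let p⊑t , t⊑W = between⁻ p∈ W∈ t∈ h in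
             ∧-true (between⁺ a∈ W∈ t∈ (p⊑t ∘ extend-⊒ a∈) t⊑W) (p⊑t (extend-∋ a∈)))
    -- A `t` without `e` is counted at exactly one `u`, namely `extend e t`. Inserting the sum over
    -- `u` thus changes nothing, and the two sums can then be exchanged.
    avoiding : ∀ {t} → t ∈ L → guard (between a W t ∧ not (mem F e t)) (g t) ≡
                               ⨁ L (λ u → guard (between p W u ∧ complement a e u t) (g t))
    avoiding {t} t∈ with between a W t ∧ not (mem F e t) in eq
    ... | false = sym (⨁-0 L λ {u} u∈ → ¬guard λ h →
            let i , c = ∧-elim {between p W u} h
                _ , u⊑W = between⁻ p∈ W∈ u∈ i
                a⊑t , e∉t , ext≡u = complement⁻ {e = e} {u} a∈ t∈ c in
            contradiction (trans (sym eq) (∧-true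
              (between⁺ a∈ W∈ t∈ a⊑t (λ x∈t → u⊑W (subst (λ u → ⟦ u ⟧ ∋ _) ext≡u (extend-⊒ t∈ x∈t)))) (not-true e∉t))) λ ())
    ... | true = sym (trans
            (⨁-point subspaces-unique (extend-∈ t∈) λ {u} u∈ u≢ → ¬guard λ h →
              u≢ (sym (proj₂ (proj₂ (complement⁻ {e = e} {u} a∈ t∈ (proj₂ (∧-elim {between p W u} h)))))))
            (cong (λ b → guard b (g t)) (∧-true
              (between⁺ p∈ W∈ (extend-∈ t∈) (extend-least a∈ (extend-∈ t∈) (extend-⊒ t∈ ∘ a⊑t) (extend-∋ t∈))
                                            (extend-least t∈ W∈ t⊑W e∈W))
              (complement⁺ a∈ t∈ a⊑t e∉t refl))))
      where
      h = ∧-elim {between a W t} eq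
      a⊑t = proj₁ (between⁻ a∈ W∈ t∈ (proj₁ h))
      t⊑W = proj₂ (between⁻ a∈ W∈ t∈ (proj₁ h))
      e∉t = not-elim (proj₂ h)
    collect : ∀ u → guard (between p W u) (g u) ⊕ ⨁ L (λ t → guard (between p W u ∧ complement a e u t) (g t)) ≡
                    guard (between p W u) (g u ⊕ ⨁ L (λ t → guard (complement a e u t) (g t)))
    collect u = sym (trans (guard-⊕ (between p W u) _ _) (cong (guard (between p W u) (g u) ⊕_)
      (trans (sym (⨁-guard L (between p W u) _)) (⨁-cong L λ {t} _ → guard-∧ (between p W u) (complement a e u t) (g t)))))

  -- Inside the join of `a` with the line, `a` is the only complement: for `x` in `t` some x + c e
  -- lies in `a` and so in `t`, and a nonzero `c` would put `e` into `t`.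
  complement-extend : ∀ {a e} v → a ∈ L → ¬ (⟦ a ⟧ ∋ e) → ⨁ L (λ t → guard (complement a e (extend e a) t) v) ≡ v
  complement-extend {a} {e} v a∈ e∉a = trans
    (⨁-point subspaces-unique a∈ λ {t} t∈ t≢a → ¬guard λ h →
      let a⊑t , e∉t , eq = complement⁻ {e = e} a∈ t∈ h in t≢a (sym (⊑-antisym a∈ t∈ a⊑t (t⊑a t∈ a⊑t e∉t eq))))
    (cong (λ b → guard b v) (complement⁺ a∈ a∈ (λ p → p) e∉a refl))
    where
    t⊑a : ∀ {t} → t ∈ L → ⟦ a ⟧ ⊑ ⟦ t ⟧ → ¬ (⟦ t ⟧ ∋ e) → extend e t ≡ extend e a → ⟦ t ⟧ ⊑ ⟦ a ⟧
    t⊑a {t} t∈ a⊑t e∉t eq {x} x∈t with extend⁻ {e} a∈ (subst (λ u → ⟦ u ⟧ ∋ x) eq (extend-⊒ t∈ x∈t))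
    ... | c , q with c ≟F 0#
    ...   | yes refl = subst (⟦ a ⟧ ∋_) (shift-0 x e) q
    ...   | no c≢0   = contradiction (∋-residue (⟦⟧-subspace t∈) c≢0 x∈t (a⊑t q)) e∉t

  -- The transvection (in characteristic 2) or reflection (otherwise) x ↦ x + φ(x) e.
  module Reflection {a : List Bool} {e : V n} (a∈ : a ∈ L) (φ : V n → Carrier) (lin : Linear φ)
    (φa : ∀ {x} → ⟦ a ⟧ ∋ x → φ x ≡ 0#) (φe : φ e ≡ -F (1# +F 1#)) where

    reflect : V n → V n
    reflect x = x ⊞ φ x · e

    -- The value -2 at `e` is what gives φ(x + φ(x) e) = φ(x) - 2 φ(x) = -φ(x), so the second shift
    -- undoes the first.
    reflect-involutive : ∀ x → reflect (reflect x) ≡ x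
    reflect-involutive x = trans (shift-shift x e (φ x) (φ (reflect x)))
      (trans (cong (λ c → x ⊞ c · e) coeff) (shift-0 x e))
      where
      open ≡-Reasoning
      coeff : φ x +F φ (x ⊞ φ x · e) ≡ 0#
      coeff = begin
        φ x +F φ (x ⊞ φ x · e)                     ≡⟨ cong (φ x +F_) (φ-shift lin x (φ x) e) ⟩
        φ x +F (φ x +F φ x *F φ e)                 ≡⟨ R.+-assoc (φ x) (φ x) _ ⟨
        (φ x +F φ x) +F φ x *F φ e                 ≡⟨ cong₂ (λ y z → (y +F y) +F φ x *F z) (sym (R.*-identityʳ (φ x))) φe ⟩
        (φ x *F 1# +F φ x *F 1#) +F φ x *F -F (1# +F 1#) ≡⟨ cong (_+F φ x *F -F (1# +F 1#)) (R.distribˡ (φ x) 1# 1#) ⟨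
        φ x *F (1# +F 1#) +F φ x *F -F (1# +F 1#)  ≡⟨ R.distribˡ (φ x) _ _ ⟨
        φ x *F ((1# +F 1#) +F -F (1# +F 1#))       ≡⟨ cong (φ x *F_) (R.-‿inverseʳ (1# +F 1#)) ⟩
        φ x *F 0#                                  ≡⟨ R.zeroʳ (φ x) ⟩
        0#                                         ∎

    reflect-fixed : ∀ {x} → φ x ≡ 0# → reflect x ≡ x
    reflect-fixed {x} eq = trans (cong (λ c → x ⊞ c · e) eq) (shift-0 x e)

    reflect-⊞ : ∀ x y → reflect x ⊞ reflect y ≡ reflect (x ⊞ y)
    reflect-⊞ x y = begin
      (x ⊞ φ x · e) ⊞ (y ⊞ φ y · e)    ≡⟨ ⊞-assoc (x ⊞ φ x · e) y (φ y · e) ⟨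
      ((x ⊞ φ x · e) ⊞ y) ⊞ φ y · e    ≡⟨ cong (_⊞ φ y · e) (⊞-swapʳ x (φ x · e) y) ⟩
      ((x ⊞ y) ⊞ φ x · e) ⊞ φ y · e    ≡⟨ shift-shift (x ⊞ y) e (φ x) (φ y) ⟩
      (x ⊞ y) ⊞ (φ x +F φ y) · e       ≡⟨ cong (λ c → (x ⊞ y) ⊞ c · e) (φ-⊞ lin x y) ⟨
      (x ⊞ y) ⊞ φ (x ⊞ y) · e          ∎
      where open ≡-Reasoning

    reflect-· : ∀ c x → c · reflect x ≡ reflect (c · x)
    reflect-· c x = trans (·-distribˡ c x (φ x · e))
      (cong (c · x ⊞_) (trans (·-assoc c (φ x) e) (cong (_· e) (sym (φ-· lin c x)))))

    -- This is the preimage, which needs no search; `reflect` being an involution, it is the image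
    -- as well.
    image : List Bool → List Bool
    image t = reify (⟦ t ⟧ ∘ reflect)

    module _ {t : List Bool} (t∈ : t ∈ L) where

      private s = ⟦⟧-subspace t∈

      image-∈ : image t ∈ L
      image-∈ = reify-∈ (record
        { ∋-𝟎 = subst (⟦ t ⟧ ∋_) (sym (reflect-fixed (φa (∋-𝟎 (⟦⟧-subspace a∈))))) (∋-𝟎 s)
        ; ∋-⊞ = λ {x} {y} p q → subst (⟦ t ⟧ ∋_) (reflect-⊞ x y) (∋-⊞ s p q)
        ; ∋-· = λ c {x} p → subst (⟦ t ⟧ ∋_) (reflect-· c x) (∋-· s c p)
        })

      image⁺ : ∀ {x} → ⟦ t ⟧ ∋ reflect x → ⟦ image t ⟧ ∋ x
      image⁺ = reify⁺ (⟦ t ⟧ ∘ reflect)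

      image⁻ : ∀ {x} → ⟦ image t ⟧ ∋ x → ⟦ t ⟧ ∋ reflect x
      image⁻ = reify⁻ (⟦ t ⟧ ∘ reflect)

    image-involutive : ∀ {t} → t ∈ L → image (image t) ≡ t
    image-involutive {t} t∈ = ⊑-antisym (image-∈ (image-∈ t∈)) t∈
      (λ {x} p → subst (⟦ t ⟧ ∋_) (reflect-involutive x) (image⁻ t∈ (image⁻ (image-∈ t∈) p)))
      (λ {x} p → image⁺ (image-∈ t∈) (image⁺ t∈ (subst (⟦ t ⟧ ∋_) (sym (reflect-involutive x)) p)))

    -- `reflect` sends `e` to (1 - 2) e = -e and so preserves its line.
    image-∌e : ∀ {t} → t ∈ L → ¬ (⟦ t ⟧ ∋ e) → ¬ (⟦ image t ⟧ ∋ e)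
    image-∌e {t} t∈ e∉t p = e∉t (subst (⟦ t ⟧ ∋_) eq (∋-· s (-F 1#) (image⁻ t∈ p)))
      where
      s = ⟦⟧-subspace t∈
      open ≡-Reasoning
      coeff : 1# +F -F (1# +F 1#) ≡ -F 1#
      coeff = begin
        1# +F -F (1# +F 1#)         ≡⟨ cong (1# +F_) (R.-‿+-comm 1# 1#) ⟨
        1# +F (-F 1# +F -F 1#)      ≡⟨ R.+-assoc 1# (-F 1#) (-F 1#) ⟨
        (1# +F -F 1#) +F -F 1#      ≡⟨ cong (_+F -F 1#) (R.-‿inverseʳ 1#) ⟩
        0# +F -F 1#                 ≡⟨ R.+-identityˡ (-F 1#) ⟩
        -F 1#                       ∎
      eq : (-F 1#) · reflect e ≡ e
      eq = begin
        (-F 1#) · (e ⊞ φ e · e)          ≡⟨ cong (λ x → (-F 1#) · (x ⊞ φ e · e)) (1·x≡x e) ⟨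
        (-F 1#) · (1# · e ⊞ φ e · e)     ≡⟨ cong ((-F 1#) ·_) (·-distribʳ 1# (φ e) e) ⟨
        (-F 1#) · (1# +F φ e) · e        ≡⟨ cong (λ c → (-F 1#) · c · e) (trans (cong (1# +F_) φe) coeff) ⟩
        (-F 1#) · (-F 1#) · e            ≡⟨ ·-assoc (-F 1#) (-F 1#) e ⟩
        (-F 1# *F -F 1#) · e             ≡⟨ cong (_· e) (trans (R.-1*x≈-x (-F 1#)) (R.-‿involutive 1#)) ⟩
        1# · e                           ≡⟨ 1·x≡x e ⟩
        e                                ∎

    -- Vectors move only along `e`, so the join with its line does not change. One inclusion,
    -- applied to `t` and to `image t`, gives both.
    extend-image : ∀ {t} → t ∈ L → extend e (image t) ≡ extend e t
    extend-image {t} t∈ = ⊑-antisym (extend-∈ (image-∈ t∈)) (extend-∈ t∈) (into t∈)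
      (λ {x} p → into (image-∈ t∈) (subst (λ t → ⟦ extend e t ⟧ ∋ x) (sym (image-involutive t∈)) p))
      where
      into : ∀ {t} → t ∈ L → ⟦ extend e (image t) ⟧ ⊑ ⟦ extend e t ⟧
      into {t} t∈ {x} p with extend⁻ {e} (image-∈ t∈) p
      ... | c , q = extend⁺ t∈ (c +F φ (x ⊞ c · e)) (subst (⟦ t ⟧ ∋_) (shift-shift x e c _) (image⁻ t∈ q))

    -- A fixed `t` contains both x and x + φ(x) e, hence φ(x) e; as `e` is outside, φ(x) must
    -- vanish.
    fixed⇒φ≡0 : ∀ {t x} → t ∈ L → ¬ (⟦ t ⟧ ∋ e) → t ≡ image t → ⟦ t ⟧ ∋ x → φ x ≡ 0#
    fixed⇒φ≡0 {t} {x} t∈ e∉t eq x∈t with φ x ≟F 0#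
    ... | yes φx≡0 = φx≡0
    ... | no  φx≢0 = contradiction (∋-residue (⟦⟧-subspace t∈) φx≢0 x∈t (image⁻ t∈ (subst (λ t → ⟦ t ⟧ ∋ x) eq x∈t))) e∉t

    -- `reflect` fixes `a` pointwise and preserves the line of `e`, so `image` permutes the
    -- complements within `u`, and those it moves cancel in pairs.
    complement-fixed : ∀ u v → ⨁ L (λ t → guard (complement a e u t) v) ≡
                               ⨁ L (λ t → guard (complement a e u t ∧ does (t ≟ᴸ image t)) v)
    complement-fixed u v = ⨁-involution _≟ᴸ_ L subspaces-unique (complement a e u) image (λ t∈ c →
      let a⊑t , e∉t , eq = complement⁻ {e = e} {u} a∈ t∈ c in
      image-∈ t∈ ,
      complement⁺ a∈ (image-∈ t∈) (λ x∈a → image⁺ t∈ (subst (⟦ _ ⟧ ∋_) (sym (reflect-fixed (φa x∈a))) (a⊑t x∈a)))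
        (image-∌e t∈ e∉t) (trans (extend-image t∈) eq) ,
      image-involutive t∈) v

  -- A fixed complement lies in the kernel of φ by `fixed⇒φ≡0`. As φ(e) = -2 is nonzero, the kernel
  -- within `u` avoids `e` and is itself a complement, which leaves room for no other.
  complement-odd : ∀ {a e u} v → 1# +F 1# ≢ 0# → a ∈ L → u ∈ L → ¬ (⟦ a ⟧ ∋ e) → ⟦ a ⟧ ⊑ ⟦ u ⟧ → ⟦ u ⟧ ∋ e →
                   ⨁ L (λ t → guard (complement a e u t) v) ≡ v
  complement-odd {a} {e} {u} v 2≢0 a∈ u∈ e∉a a⊑u e∈u = trans (complement-fixed u v) (trans
    (⨁-point subspaces-unique ker∈ λ {t} t∈ t≢ker → ¬guard λ h → t≢ker (only t∈ (∧-elim {complement a e u t} h)))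
    (cong (λ b → guard b v) (∧-true
      (complement⁺ a∈ ker∈ (λ x∈a → ker⁺ (a⊑u x∈a) (φa x∈a)) e∉ker ker-generates)
      (dec-true (ker ≟ᴸ image ker) ker-fixed))))
    where
    sep = separate (⟦⟧-subspace a∈) e∉a
    ψ = proj₁ sep
    linψ = proj₁ (proj₂ sep)
    m2 = -F (1# +F 1#)
    φ : V n → Carrier
    φ x = m2 *F ψ x
    lin : Linear φ
    lin = record
      { φ-⊞ = λ x y → trans (cong (m2 *F_) (φ-⊞ linψ x y)) (R.distribˡ m2 _ _)
      ; φ-· = λ c x → trans (cong (m2 *F_) (φ-· linψ c x)) (trans (sym (R.*-assoc m2 c _))
                (trans (cong (_*F ψ x) (R.*-comm m2 c)) (R.*-assoc c m2 _))) }
    φa : ∀ {x} → ⟦ a ⟧ ∋ x → φ x ≡ 0#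
    φa x∈a = trans (cong (m2 *F_) (proj₁ (proj₂ (proj₂ sep)) x∈a)) (R.zeroʳ m2)
    φe : φ e ≡ m2
    φe = trans (cong (m2 *F_) (proj₂ (proj₂ (proj₂ sep)))) (R.*-identityʳ m2)
    φe≢0 : φ e ≢ 0#
    φe≢0 eq = 2≢0 (trans (sym (R.-‿involutive _)) (trans (cong -F_ (trans (sym φe) eq)) R.-0#≈0#))
    open Reflection a∈ φ lin φa φe
    sU = ⟦⟧-subspace u∈
    kerP : V n → Bool
    kerP x = ⟦ u ⟧ x ∧ does (φ x ≟F 0#)
    ker = reify kerP
    kerP⁺ : ∀ {x} → ⟦ u ⟧ ∋ x → φ x ≡ 0# → kerP ∋ x
    kerP⁺ {x} p q = ∧-true p (dec-true (φ x ≟F 0#) q)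
    kerP⁻ : ∀ {x} → kerP ∋ x → ⟦ u ⟧ ∋ x × φ x ≡ 0#
    kerP⁻ {x} h = let p , q = ∧-elim {⟦ u ⟧ x} h in p , does-elim (φ x ≟F 0#) q
    ker⁺ : ∀ {x} → ⟦ u ⟧ ∋ x → φ x ≡ 0# → ⟦ ker ⟧ ∋ x
    ker⁺ p q = reify⁺ kerP (kerP⁺ p q)
    ker⁻ : ∀ {x} → ⟦ ker ⟧ ∋ x → ⟦ u ⟧ ∋ x × φ x ≡ 0#
    ker⁻ p = kerP⁻ (reify⁻ kerP p)
    ker∈ : ker ∈ L
    ker∈ = reify-∈ (record
      { ∋-𝟎 = kerP⁺ (∋-𝟎 sU) (φa (∋-𝟎 (⟦⟧-subspace a∈)))
      ; ∋-⊞ = λ {x} {y} p q → let p₁ , p₂ = kerP⁻ p ; q₁ , q₂ = kerP⁻ q in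
          kerP⁺ (∋-⊞ sU p₁ q₁) (trans (φ-⊞ lin x y) (trans (cong₂ _+F_ p₂ q₂) (R.+-identityˡ 0#)))
      ; ∋-· = λ c {x} p → let p₁ , p₂ = kerP⁻ p in
          kerP⁺ (∋-· sU c p₁) (trans (φ-· lin c x) (trans (cong (c *F_) p₂) (R.zeroʳ c)))
      })
    e∉ker : ¬ (⟦ ker ⟧ ∋ e)
    e∉ker p = φe≢0 (proj₂ (ker⁻ p))
    -- Shifting `x` by -φ(x)/φ(e) along `e` brings it into the kernel.
    ker-generates : extend e ker ≡ u
    ker-generates = ⊑-antisym (extend-∈ ker∈) u∈ (extend-least ker∈ u∈ (proj₁ ∘ ker⁻) e∈u) λ {x} x∈u →
      extend⁺ ker∈ (-F (φ x *F d)) (ker⁺ (∋-shift sU _ x∈u e∈u) (trans (φ-shift lin x _ e) (coeff (φ x))))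
      where
      d = proj₁ (inverse (φ e) φe≢0)
      open ≡-Reasoning
      coeff : ∀ c → c +F -F (c *F d) *F φ e ≡ 0#
      coeff c = begin
        c +F -F (c *F d) *F φ e    ≡⟨ cong (c +F_) (R.-‿distribˡ-* (c *F d) (φ e)) ⟨
        c +F -F (c *F d *F φ e)    ≡⟨ cong (λ x → c +F -F x) (R.*-assoc c d (φ e)) ⟩
        c +F -F (c *F (d *F φ e))  ≡⟨ cong (λ x → c +F -F (c *F x)) (trans (R.*-comm d (φ e)) (proj₂ (inverse (φ e) φe≢0))) ⟩
        c +F -F (c *F 1#)          ≡⟨ cong (λ x → c +F -F x) (R.*-identityʳ c) ⟩
        c +F -F c                  ≡⟨ R.-‿inverseʳ c ⟩
        0#                         ∎
    ker-fixed : ker ≡ image ker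
    ker-fixed = ⊑-antisym ker∈ (image-∈ ker∈)
      (λ p → image⁺ ker∈ (subst (⟦ ker ⟧ ∋_) (sym (reflect-fixed (proj₂ (ker⁻ p)))) p))
      (λ {x} p → let q = image⁻ ker∈ p in
        subst (⟦ ker ⟧ ∋_) (trans (sym (reflect-fixed (proj₂ (ker⁻ q)))) (reflect-involutive x)) q)
    only : ∀ {t} → t ∈ L → complement a e u t ≡ true × does (t ≟ᴸ image t) ≡ true → t ≡ ker
    only {t} t∈ (h , fix) with complement⁻ {e = e} {u} a∈ t∈ h | does-elim (t ≟ᴸ image t) fix
    ... | a⊑t , e∉t , eq | fixed = ⊑-antisym t∈ ker∈
      (λ {x} x∈t → ker⁺ (subst (λ u → ⟦ u ⟧ ∋ x) eq (extend-⊒ t∈ x∈t)) (fixed⇒φ≡0 t∈ e∉t fixed x∈t))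
      back
      where
      -- Some x + c e lies in `t`, where φ vanishes; since φ(x) = 0 as well, c φ(e) = 0 and `c` is
      -- zero.
      back : ⟦ ker ⟧ ⊑ ⟦ t ⟧
      back {x} p with ker⁻ p
      ... | x∈u , φx≡0 with extend⁻ {e} t∈ (subst (λ u → ⟦ u ⟧ ∋ x) (sym eq) x∈u)
      ... | c , q with *F-cancel-0 φe≢0 (trans (sym (trans (cong (_+F c *F φ e) φx≡0) (R.+-identityˡ _)))
                         (trans (sym (φ-shift lin x c e)) (fixed⇒φ≡0 t∈ e∉t fixed q)))
      ... | refl = subst (⟦ t ⟧ ∋_) (shift-0 x e) q

  -- Choose φ to vanish on the join p of `a` with the line and to be 1 at some `y` in `u` outside p.
  -- A fixed complement would lie in the kernel of φ, and then so would its join `u` with the line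
  -- of `e`, which contains `y`.
  complement-even : ∀ {a e u} v → 1# +F 1# ≡ 0# → a ∈ L → u ∈ L → ⟦ extend e a ⟧ ⊑ ⟦ u ⟧ → u ≢ extend e a →
                    ⨁ L (λ t → guard (complement a e u t) v) ≡ 0
  complement-even {a} {e} {u} v 2≡0 a∈ u∈ p⊑u u≢p with ⊑-or-missing u (extend e a)
  ... | inj₁ u⊑p = contradiction (⊑-antisym u∈ (extend-∈ a∈) u⊑p p⊑u) u≢p
  ... | inj₂ (y , y∈u , y∉p) = trans (complement-fixed u v)
      (⨁-0 L λ {t} t∈ → ¬guard λ h → none t∈ (∧-elim {complement a e u t} h))
    where
    sep = separate (⟦⟧-subspace (extend-∈ a∈)) y∉p
    φ = proj₁ sep
    lin = proj₁ (proj₂ sep)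
    φp : ∀ {x} → ⟦ extend e a ⟧ ∋ x → φ x ≡ 0#
    φp = proj₁ (proj₂ (proj₂ sep))
    φe : φ e ≡ 0#
    φe = φp (extend-∋ a∈)
    -- In characteristic 2 the required value -2 is zero, which agrees with φ vanishing on `e`.
    open Reflection {a} {e} a∈ φ lin (φp ∘ extend-⊒ a∈) (trans φe (sym (trans (cong -F_ 2≡0) R.-0#≈0#)))
    none : ∀ {t} → t ∈ L → ¬ (complement a e u t ≡ true × does (t ≟ᴸ image t) ≡ true)
    none {t} t∈ (h , fix) with complement⁻ {e = e} {u} a∈ t∈ h | does-elim (t ≟ᴸ image t) fix
    ... | a⊑t , e∉t , eq | fixed with extend⁻ {e} t∈ (subst (λ u → ⟦ u ⟧ ∋ y) (sym eq) y∈u)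
    ... | c , q = 0≢1 (trans (sym (fixed⇒φ≡0 t∈ e∉t fixed q)) (trans (φ-shift lin y c e)
      (trans (cong₂ (λ x z → x +F c *F z) (proj₂ (proj₂ (proj₂ sep))) φe)
        (trans (cong (1# +F_) (R.zeroʳ c)) (R.+-identityʳ 1#)))))

  intervalSum-self : ∀ {W} g → W ∈ L → intervalSum g W W ≡ g W
  intervalSum-self {W} g W∈ = trans
    (⨁-point subspaces-unique W∈ λ {t} t∈ t≢W → ¬guard λ h →
      let p , q = between⁻ W∈ W∈ t∈ h in t≢W (⊑-antisym t∈ W∈ q p))
    (cong (λ b → guard b (g W)) (between⁺ W∈ W∈ W∈ (λ p → p) (λ p → p)))

  ⊑∧Dim≡⇒≡ : ∀ {a W} → a ∈ L → W ∈ L → ⟦ a ⟧ ⊑ ⟦ W ⟧ → Dim a ≡ Dim W → a ≡ W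
  ⊑∧Dim≡⇒≡ a∈ W∈ a⊑W eq = ⊑-antisym a∈ W∈ a⊑W
    (dim-≤⇒⊒ (⟦⟧-subspace a∈) (⟦⟧-subspace W∈) a⊑W (≤-reflexive (sym eq)))

  proper-missing : ∀ {a W} → Dim a < Dim W → ∃ λ e → ⟦ W ⟧ ∋ e × ¬ (⟦ a ⟧ ∋ e)
  proper-missing {a} {W} lt with ⊑-or-missing W a
  ... | inj₁ W⊑a = contradiction (dim-mono ⟦ W ⟧ ⟦ a ⟧ W⊑a) (<⇒≱ lt)
  ... | inj₂ m   = m

  -- The sequence `G` is quantified after `m` because each step shifts it: `u` of dimension k + 1
  -- collects its own G(k + 1) and an odd number of copies of G(k), together G(k + 2). After `m`
  -- steps only `W` remains, with `G` shifted by `m`.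
  intervalSum-odd : 1# +F 1# ≢ 0# → ∀ m {a W} → a ∈ L → W ∈ L → ⟦ a ⟧ ⊑ ⟦ W ⟧ → m + Dim a ≡ Dim W →
    ∀ (G : ℕ → ℕ) → (∀ k → G k ⊕ G (suc k) ≡ G (2 + k)) → intervalSum (G ∘ Dim) a W ≡ G (m + Dim W)
  intervalSum-odd 2≢0 zero a∈ W∈ a⊑W eq G fib with ⊑∧Dim≡⇒≡ a∈ W∈ a⊑W eq
  ... | refl = intervalSum-self (G ∘ Dim) W∈
  intervalSum-odd 2≢0 (suc m) {a} {W} a∈ W∈ a⊑W eq G fib with proper-missing {a} {W} (≤-trans (s≤s (m≤n+m _ m)) (≤-reflexive eq))
  ... | e , e∈W , e∉a = begin
    intervalSum (G ∘ Dim) a W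
      ≡⟨ intervalSum-split (G ∘ Dim) a∈ W∈ a⊑W e∈W ⟩
    ⨁ L (λ u → guard (between p W u) (G (Dim u) ⊕ ⨁ L (λ t → guard (complement a e u t) (G (Dim t)))))
      ≡⟨ ⨁-cong L (λ {u} u∈ → guard-cong (between p W u) (step u∈ ∘ proj₁ ∘ between⁻ p∈ W∈ u∈)) ⟩
    intervalSum (G ∘ suc ∘ Dim) p W
      ≡⟨ intervalSum-odd 2≢0 m p∈ W∈ (extend-least a∈ W∈ a⊑W e∈W)
           (trans (cong (m +_) (Dim-extend a∈ e∉a)) (trans (+-suc m (Dim a)) eq)) (G ∘ suc) (fib ∘ suc) ⟩
    G (suc m + Dim W) ∎
    where
    open ≡-Reasoning
    p = extend e a
    p∈ = extend-∈ {e} a∈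
    step : ∀ {u} → u ∈ L → ⟦ p ⟧ ⊑ ⟦ u ⟧ →
           G (Dim u) ⊕ ⨁ L (λ t → guard (complement a e u t) (G (Dim t))) ≡ G (suc (Dim u))
    step {u} u∈ p⊑u with Dim u in Du
    ... | zero = contradiction (≤-trans (≤-reflexive (sym (Dim-extend a∈ e∉a))) (≤-trans (dim-mono ⟦ p ⟧ ⟦ u ⟧ p⊑u) (≤-reflexive Du))) λ ()
    ... | suc k = trans (cong (G (suc k) ⊕_) (trans (⨁-cong L (λ {t} t∈ → guard-cong (complement a e u t) (same t∈)))
                          (complement-odd (G k) 2≢0 a∈ u∈ e∉a (p⊑u ∘ extend-⊒ a∈) (p⊑u (extend-∋ a∈)))))
                        (trans (⊕-comm (G (suc k)) (G k)) (fib k))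
      where
      same : ∀ {t} → t ∈ L → complement a e u t ≡ true → G (Dim t) ≡ G k
      same {t} t∈ c with complement⁻ {e = e} {u} a∈ t∈ c
      ... | _ , e∉t , ext≡u = cong G (suc-injective (trans (sym (Dim-extend t∈ e∉t)) (trans (cong Dim ext≡u) Du)))

  -- Every `u` other than `p` collects an even number of equal terms, and `p` collects just that of
  -- `a`. The sum over the interval is therefore the sum along a maximal chain from `a` to `W`,
  -- which telescopes.
  intervalSum-even : 1# +F 1# ≡ 0# → ∀ m {a W} → a ∈ L → W ∈ L → ⟦ a ⟧ ⊑ ⟦ W ⟧ → m + Dim a ≡ Dim W →
    ∀ (T : ℕ → ℕ) → intervalSum (λ t → T (Dim t) ⊕ T (suc (Dim t))) a W ≡ T (Dim a) ⊕ T (suc (Dim W))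
  intervalSum-even 2≡0 zero a∈ W∈ a⊑W eq T with ⊑∧Dim≡⇒≡ a∈ W∈ a⊑W eq
  ... | refl = intervalSum-self _ W∈
  intervalSum-even 2≡0 (suc m) {a} {W} a∈ W∈ a⊑W eq T with proper-missing {a} {W} (≤-trans (s≤s (m≤n+m _ m)) (≤-reflexive eq))
  ... | e , e∈W , e∉a = begin
    intervalSum g a W
      ≡⟨ intervalSum-split g a∈ W∈ a⊑W e∈W ⟩
    ⨁ L (λ u → guard (between p W u) (g u ⊕ ⨁ L (λ t → guard (complement a e u t) (g t))))
      ≡⟨ ⨁-cong L (λ {u} u∈ → trans (guard-cong (between p W u) (λ i → cong (g u ⊕_) (step u∈ (proj₁ (between⁻ p∈ W∈ u∈ i)))))
                                    (guard-⊕ (between p W u) (g u) _)) ⟩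
    ⨁ L (λ u → guard (between p W u) (g u) ⊕ guard (between p W u) (guard (does (u ≟ᴸ p)) (g a)))
      ≡⟨ ⨁-⊕ L _ _ ⟩
    intervalSum g p W ⊕ ⨁ L (λ u → guard (between p W u) (guard (does (u ≟ᴸ p)) (g a)))
      ≡⟨ cong₂ _⊕_ (intervalSum-even 2≡0 m p∈ W∈ p⊑W (trans (cong (m +_) Dp) (trans (+-suc m (Dim a)) eq)) T) at-p ⟩
    (T (Dim p) ⊕ T (suc (Dim W))) ⊕ g a
      ≡⟨ ⊕-comm _ (g a) ⟩
    (T (Dim a) ⊕ T (suc (Dim a))) ⊕ (T (Dim p) ⊕ T (suc (Dim W)))
      ≡⟨ cong (λ d → (T (Dim a) ⊕ T (suc (Dim a))) ⊕ (T d ⊕ T (suc (Dim W)))) Dp ⟩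
    (T (Dim a) ⊕ T (suc (Dim a))) ⊕ (T (suc (Dim a)) ⊕ T (suc (Dim W)))
      ≡⟨ trans (⊕-assoc (T (Dim a)) _ _) (cong (T (Dim a) ⊕_) (⊕-cancelˡ (T (suc (Dim a))) _)) ⟩
    T (Dim a) ⊕ T (suc (Dim W)) ∎
    where
    open ≡-Reasoning
    g : List Bool → ℕ
    g t = T (Dim t) ⊕ T (suc (Dim t))
    p = extend e a
    p∈ = extend-∈ {e} a∈
    p⊑W : ⟦ p ⟧ ⊑ ⟦ W ⟧
    p⊑W = extend-least a∈ W∈ a⊑W e∈W
    Dp = Dim-extend {e} a∈ e∉a
    same : ∀ {u t} → t ∈ L → Dim u ≡ Dim p → complement a e u t ≡ true → g t ≡ g a
    same {u} t∈ Du c with complement⁻ {e = e} {u} a∈ t∈ c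
    ... | _ , e∉t , ext≡u = cong (λ d → T d ⊕ T (suc d))
            (suc-injective (trans (sym (Dim-extend t∈ e∉t)) (trans (cong Dim ext≡u) (trans Du Dp))))
    step : ∀ {u} → u ∈ L → ⟦ p ⟧ ⊑ ⟦ u ⟧ → ⨁ L (λ t → guard (complement a e u t) (g t)) ≡ guard (does (u ≟ᴸ p)) (g a)
    step {u} u∈ p⊑u with u ≟ᴸ p
    ... | yes refl = trans (⨁-cong L (λ {t} t∈ → guard-cong (complement a e u t) (same {u} t∈ refl))) (complement-extend (g a) a∈ e∉a)
    ... | no u≢p = trans (⨁-cong L (λ {t} t∈ → guard-cong (complement a e u t) (level t∈)))
                         (complement-even _ 2≡0 a∈ u∈ p⊑u u≢p)
      where
      -- `pred` names the common dimension of the complements without first exhibiting `Dim u` as a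
      -- successor.
      level : ∀ {t} → t ∈ L → complement a e u t ≡ true → g t ≡ T (pred (Dim u)) ⊕ T (suc (pred (Dim u)))
      level t∈ c with complement⁻ {e = e} {u} a∈ t∈ c
      ... | _ , e∉t , ext≡u = cong (λ d → T d ⊕ T (suc d)) (cong pred (trans (sym (Dim-extend t∈ e∉t)) (cong Dim ext≡u)))
    at-p : ⨁ L (λ u → guard (between p W u) (guard (does (u ≟ᴸ p)) (g a))) ≡ g a
    at-p = trans (⨁-point subspaces-unique p∈ λ {u} _ u≢p →
                    trans (cong (λ b → guard (between p W u) (guard b (g a))) (dec-false (u ≟ᴸ p) u≢p)) (guard-0 (between p W u)))
                 (cong₂ (λ b c → guard b (guard c (g a))) (between⁺ p∈ W∈ p∈ (λ x → x) p⊑W) (dec-true (p ≟ᴸ p) refl))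

  -- Option values turn out to depend on `a` through its dimension only, so realising each dimension
  -- inside `W` realises every option value.
  subspace-of-dim : ∀ {W} → W ∈ L → ∀ k → k ≤ Dim W → ∃ λ a → a ∈ L × ⟦ a ⟧ ⊑ ⟦ W ⟧ × Dim a ≡ k
  subspace-of-dim W∈ zero _ = reify zeroP , reify-∈ zeroP-subspace ,
    (λ p → zeroP-⊑ (⟦⟧-subspace W∈) (reify⁻ zeroP p)) , trans (dim-reify zeroP) (dim-trivial zeroP⁻)
  subspace-of-dim {W} W∈ (suc k) k<d with subspace-of-dim W∈ k (<⇒≤ k<d)
  ... | a , a∈ , a⊑W , refl with proper-missing {a} {W} k<d
  ...   | e , e∈W , e∉a = extend e a , extend-∈ a∈ , extend-least a∈ W∈ a⊑W e∈W , Dim-extend a∈ e∉a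

  ≤ᴸ-trans : ∀ {x y z} → x ∈ L → y ∈ L → z ∈ L → (x ≤ᴸ y) ≡ true → (y ≤ᴸ z) ≡ true → (x ≤ᴸ z) ≡ true
  ≤ᴸ-trans x∈ y∈ z∈ p q = ⊑⇒⊆ x∈ z∈ (⊆⇒⊑ y∈ z∈ q ∘ ⊆⇒⊑ x∈ y∈ p)

  -- An option omits `W` from its interval; nim-adding the value at `W` twice restores the full
  -- interval.
  option-value : ∀ {a W} g → a ∈ L → W ∈ L → ⟦ a ⟧ ⊑ ⟦ W ⟧ →
    nimSum (map g (filterᵇ (λ t → (a ≤ᴸ t) ∧ (t ≤ᴸ W) ∧ not (W ≤ᴸ t)) L)) ≡ g W ⊕ intervalSum g a W
  option-value {a} {W} g a∈ W∈ a⊑W = begin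
    ⨁ (filterᵇ (λ t → (a ≤ᴸ t) ∧ (t ≤ᴸ W) ∧ not (W ≤ᴸ t)) L) g
      ≡⟨ ⨁-filterᵇ _ L g ⟩
    ⨁ L (λ t → guard ((a ≤ᴸ t) ∧ (t ≤ᴸ W) ∧ not (W ≤ᴸ t)) (g t))
      ≡⟨ ⨁-cong L (λ {t} _ → cong (λ b → guard b (g t)) (sym (∧-assoc (a ≤ᴸ t) (t ≤ᴸ W) _))) ⟩
    rest
      ≡⟨ ⊕-cancelˡ (g W) rest ⟨
    g W ⊕ (g W ⊕ rest)
      ≡⟨ cong (λ x → g W ⊕ (x ⊕ rest)) top ⟨
    g W ⊕ (⨁ L (λ t → guard (between a W t ∧ (W ≤ᴸ t)) (g t)) ⊕ rest)
      ≡⟨ cong (g W ⊕_) (⨁-⊕ L _ _) ⟨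
    g W ⊕ ⨁ L (λ t → guard (between a W t ∧ (W ≤ᴸ t)) (g t) ⊕ guard (between a W t ∧ not (W ≤ᴸ t)) (g t))
      ≡⟨ cong (g W ⊕_) (⨁-cong L λ {t} _ → guard-split (between a W t) (W ≤ᴸ t) (g t)) ⟨
    g W ⊕ intervalSum g a W ∎
    where
    open ≡-Reasoning
    rest = ⨁ L (λ t → guard (between a W t ∧ not (W ≤ᴸ t)) (g t))
    top : ⨁ L (λ t → guard (between a W t ∧ (W ≤ᴸ t)) (g t)) ≡ g W
    top = trans
      (⨁-point subspaces-unique W∈ λ {t} t∈ t≢W → ¬guard λ h → let p , q = ∧-elim {between a W t} h in
        t≢W (⊑-antisym t∈ W∈ (proj₂ (between⁻ a∈ W∈ t∈ p)) (⊆⇒⊑ W∈ t∈ q)))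
      (cong (λ b → guard b (g W)) (∧-true (between⁺ a∈ W∈ W∈ a⊑W (λ x → x)) (⊑⇒⊆ W∈ W∈ (λ x → x))))

-- Grundy values

⨁-1 : ∀ {A : Set} (xs : List A) → ⨁ xs (λ _ → 1) ≡ bit (odd (length xs))
⨁-1 []       = refl
⨁-1 (x ∷ xs) rewrite ⨁-1 xs with odd (length xs)
... | false = refl
... | true  = refl

bit-injective : ∀ {a b} → bit a ≡ bit b → a ≡ b
bit-injective {false} {false} _ = refl
bit-injective {true}  {true}  _ = refl

2∣⇒¬odd : ∀ {n} → 2 ∣ n → odd n ≡ false
2∣⇒¬odd (divides q refl) = trans (cong odd (*-comm q 2)) (odd-double q)

¬odd⇒2∣ : ∀ n → odd n ≡ false → 2 ∣ n
¬odd⇒2∣ n eq with binary n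
... | false , m , refl = divides m (*-comm 2 m)
... | true  , m , refl = contradiction (trans (sym (odd-∷₂ true m)) eq) λ ()

module Characteristic (F : FiniteField) where

  open LinearAlgebra F

  private
    -- Nim-summing ones counts modulo 2. It is applied to x ↦ x + 1, which has no fixed point when 1
    -- + 1 = 0, and otherwise to negation, which fixes only zero.
    involution-parity : (σ : Carrier → Carrier) → (∀ x → σ (σ x) ≡ x) →
      bit (odd size) ≡ ⨁ elements (λ x → guard (does (x ≟F σ x)) 1)
    involution-parity σ inv = trans (sym (⨁-1 elements))
      (⨁-involution _≟F_ elements elements-unique (λ _ → true) σ (λ {x} _ _ → elements-complete (σ x) , refl , inv x) 1)

  2≡0⇒even : 1# +F 1# ≡ 0# → odd size ≡ false
  2≡0⇒even 2≡0 = bit-injective (trans (involution-parity (_+F 1#) inv)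
    (⨁-0 elements λ {x} _ → cong (λ b → guard b 1) (dec-false (x ≟F x +F 1#) (no-fix x))))
    where
    inv : ∀ x → x +F 1# +F 1# ≡ x
    inv x = trans (R.+-assoc x 1# 1#) (trans (cong (x +F_) 2≡0) (R.+-identityʳ x))
    no-fix : ∀ x → x ≢ x +F 1#
    no-fix x eq = 0≢1 (R.+-cancelˡ x 0# 1# (trans (R.+-identityʳ x) eq))

  2≢0⇒odd : 1# +F 1# ≢ 0# → odd size ≡ true
  2≢0⇒odd 2≢0 = bit-injective (trans (involution-parity -F_ R.-‿involutive) (trans
    (⨁-point elements-unique (elements-complete 0#) λ {x} _ x≢0 →
      cong (λ b → guard b 1) (dec-false (x ≟F -F x) λ eq → x≢0 (fix x eq)))
    (cong (λ b → guard b 1) (dec-true (0# ≟F -F 0#) (sym R.-0#≈0#)))))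
    where
    fix : ∀ x → x ≡ -F x → x ≡ 0#
    fix x eq = *F-cancel-0 2≢0 (trans (R.distribˡ x 1# 1#)
      (trans (cong₂ _+F_ (R.*-identityʳ x) (trans (R.*-identityʳ x) eq)) (R.-‿inverseʳ x)))

  even⇒2≡0 : 2 ∣ size → 1# +F 1# ≡ 0#
  even⇒2≡0 2∣size with 1# +F 1# ≟F 0#
  ... | yes 2≡0 = 2≡0
  ... | no  2≢0 = contradiction (trans (sym (2≢0⇒odd 2≢0)) (2∣⇒¬odd 2∣size)) λ ()

  odd⇒2≢0 : ¬ (2 ∣ size) → 1# +F 1# ≢ 0#
  odd⇒2≢0 ¬2∣size 2≡0 = ¬2∣size (¬odd⇒2∣ size (2≡0⇒even 2≡0))

-- This form makes interval sums telescope; `gray-suc` converts it to the power of 2.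
evenGrundy : ℕ → ℕ
evenGrundy d = gray d ⊕ gray (suc d)

oddGrundy : ℕ → ℕ
oddGrundy d = (d % 3) + 1

oddGrundy-periodic : ∀ d → oddGrundy (3 + d) ≡ oddGrundy d
oddGrundy-periodic d = cong (_+ 1) (trans (cong (_% 3) (+-comm 3 d)) ([m+n]%n≡m%n d 3))

-- The values 1, 2, 3 are the successive powers of a generator of the group of units of GF(4).
oddGrundy-fib : ∀ k → oddGrundy k ⊕ oddGrundy (suc k) ≡ oddGrundy (2 + k)
oddGrundy-fib 0 = refl
oddGrundy-fib 1 = refl
oddGrundy-fib 2 = refl
oddGrundy-fib (suc (suc (suc k)))
  rewrite oddGrundy-periodic k | oddGrundy-periodic (suc k) | oddGrundy-periodic (2 + k) = oddGrundy-fib k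

-- `m` is the codimension of the chosen `a` in a space of dimension `d`. For `d` below 3 the
-- codimensions 0 to `d` give exactly the values required; adding 3 to `d` alters none of them.
oddGrundy-options : ∀ d {j} → j < oddGrundy d → ∃ λ m → m ≤ d × oddGrundy d ⊕ oddGrundy (m + d) ≡ j
oddGrundy-options 0 {0} _ = 0 , z≤n , refl
oddGrundy-options 1 {0} _ = 0 , z≤n , refl
oddGrundy-options 1 {1} _ = 1 , ≤-refl , refl
oddGrundy-options 2 {0} _ = 0 , z≤n , refl
oddGrundy-options 2 {1} _ = 2 , ≤-refl , refl
oddGrundy-options 2 {2} _ = 1 , s≤s z≤n , refl
oddGrundy-options 0 {suc _} (s≤s ())
oddGrundy-options 1 {suc (suc _)} (s≤s (s≤s ()))
oddGrundy-options 2 {suc (suc (suc _))} (s≤s (s≤s (s≤s ())))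
oddGrundy-options (suc (suc (suc d))) {j} lt
  with oddGrundy-options d (subst (j <_) (oddGrundy-periodic d) lt)
... | m , m≤d , eq = m , ≤-trans m≤d (m≤n+m d 3) , trans (cong₂ _⊕_ (oddGrundy-periodic d)
        (trans (cong oddGrundy (shuffle m d)) (oddGrundy-periodic (m + d)))) eq
  where
  shuffle : ∀ m d → m + (3 + d) ≡ 3 + (m + d)
  shuffle m d = trans (sym (+-assoc m 3 d)) (trans (cong (_+ d) (+-comm m 3)) (+-assoc 3 m d))

module Grundy (F : FiniteField) (n : ℕ) where

  open IntervalSums F n

  -- The two hypotheses are the halves of the mex condition for the candidate, with each option in
  -- the form provided by `option-value`.
  grundy-unique : (G : ℕ → ℕ) →
    (∀ {W j} → W ∈ L → j < G (Dim W) →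
      ∃ λ a → a ∈ L × ⟦ a ⟧ ⊑ ⟦ W ⟧ × G (Dim W) ⊕ intervalSum (G ∘ Dim) a W ≡ j) →
    (∀ {a W} → a ∈ L → W ∈ L → ⟦ a ⟧ ⊑ ⟦ W ⟧ → G (Dim W) ⊕ intervalSum (G ∘ Dim) a W ≢ G (Dim W)) →
    ∀ {W} → W ∈ L → grundyB F n W ≡ G (Dim W)
  grundy-unique G reach avoid = rulerGrundy-unique L _≤ᴸ_ ≤ᴸ-trans (G ∘ Dim) λ {W} W∈ →
    mex-correct (rulerOptions L _≤ᴸ_ (G ∘ Dim) W)
      (λ {j} lt → let a , a∈ , a⊑W , eq = reach W∈ lt in
        subst (_∈ rulerOptions L _≤ᴸ_ (G ∘ Dim) W) (trans (option-value (G ∘ Dim) a∈ W∈ a⊑W) eq)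
          (∈-map⁺ (opt W) (∈-filterᵇ⁺ (_≤ᴸ W) a∈ (⊑⇒⊆ a∈ W∈ a⊑W))))
      (λ G∈ → let a , a∈f , eq = ∈-map⁻ (opt W) G∈ ; a∈ , a≤W = ∈-filterᵇ⁻ (_≤ᴸ W) {xs = L} a∈f ; a⊑W = ⊆⇒⊑ a∈ W∈ a≤W in
        avoid a∈ W∈ a⊑W (trans (sym (option-value (G ∘ Dim) a∈ W∈ a⊑W)) (sym eq)))
    where
    opt : List Bool → List Bool → ℕ
    opt W a = nimSum (map (G ∘ Dim) (filterᵇ (λ t → (a ≤ᴸ t) ∧ (t ≤ᴸ W) ∧ not (W ≤ᴸ t)) L))

  codim : ∀ {a W} → ⟦ a ⟧ ⊑ ⟦ W ⟧ → (Dim W ∸ Dim a) + Dim a ≡ Dim W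
  codim {a} {W} a⊑W = m∸n+n≡m (dim-mono ⟦ a ⟧ ⟦ W ⟧ a⊑W)

  grundy-even : 1# +F 1# ≡ 0# → ∀ {W} → W ∈ L → grundyB F n W ≡ evenGrundy (Dim W)
  grundy-even 2≡0 = grundy-unique evenGrundy reach avoid
    where
    value : ∀ {a W} → a ∈ L → W ∈ L → ⟦ a ⟧ ⊑ ⟦ W ⟧ →
            evenGrundy (Dim W) ⊕ intervalSum (evenGrundy ∘ Dim) a W ≡ gray (Dim a) ⊕ gray (Dim W)
    value {a} {W} a∈ W∈ a⊑W = begin
      (gray d ⊕ gray (suc d)) ⊕ intervalSum (evenGrundy ∘ Dim) a W
        ≡⟨ cong ((gray d ⊕ gray (suc d)) ⊕_) (intervalSum-even 2≡0 (d ∸ Dim a) a∈ W∈ a⊑W (codim a⊑W) gray) ⟩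
      (gray d ⊕ gray (suc d)) ⊕ (gray (Dim a) ⊕ gray (suc d))
        ≡⟨ ⊕-interchange (gray d) _ _ _ ⟩
      (gray d ⊕ gray (Dim a)) ⊕ (gray (suc d) ⊕ gray (suc d))
        ≡⟨ cong ((gray d ⊕ gray (Dim a)) ⊕_) (⊕-self (gray (suc d))) ⟩
      (gray d ⊕ gray (Dim a)) ⊕ 0
        ≡⟨ trans (⊕-identityʳ _) (⊕-comm (gray d) _) ⟩
      gray (Dim a) ⊕ gray d ∎
      where
      open ≡-Reasoning
      d = Dim W
    reach : ∀ {W j} → W ∈ L → j < evenGrundy (Dim W) →
      ∃ λ a → a ∈ L × ⟦ a ⟧ ⊑ ⟦ W ⟧ × evenGrundy (Dim W) ⊕ intervalSum (evenGrundy ∘ Dim) a W ≡ j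
    reach {W} {j} W∈ lt with gray-suc (Dim W)
    ... | k , eq , dvd , _ with gray-block k (Dim W) j dvd (subst (j <_) eq lt)
    ... | i , i≤d , val with subspace-of-dim W∈ i i≤d
    ... | a , a∈ , a⊑W , refl = a , a∈ , a⊑W , trans (value a∈ W∈ a⊑W) val
    avoid : ∀ {a W} → a ∈ L → W ∈ L → ⟦ a ⟧ ⊑ ⟦ W ⟧ →
      evenGrundy (Dim W) ⊕ intervalSum (evenGrundy ∘ Dim) a W ≢ evenGrundy (Dim W)
    -- Cancelling gray(dim W) makes the Gray codes of dim a and dim W + 1 agree, so `a` would have
    -- larger dimension than the `W` containing it.
    avoid {a} {W} a∈ W∈ a⊑W eq = contradiction (dim-mono ⟦ a ⟧ ⟦ W ⟧ a⊑W) (<⇒≱ (≤-reflexive (sym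
      (gray-injective (Dim a) (suc (Dim W)) (begin
        gray (Dim a)                            ≡⟨ ⊕-cancelˡ (gray d) _ ⟨
        gray d ⊕ (gray d ⊕ gray (Dim a))        ≡⟨ cong (gray d ⊕_) (⊕-comm (gray d) _) ⟩
        gray d ⊕ (gray (Dim a) ⊕ gray d)        ≡⟨ cong (gray d ⊕_) (trans (sym (value a∈ W∈ a⊑W)) eq) ⟩
        gray d ⊕ (gray d ⊕ gray (suc d))        ≡⟨ ⊕-cancelˡ (gray d) _ ⟩
        gray (suc d)                            ∎)))))
      where
      open ≡-Reasoning
      d = Dim W

  grundy-odd : 1# +F 1# ≢ 0# → ∀ {W} → W ∈ L → grundyB F n W ≡ oddGrundy (Dim W)
  grundy-odd 2≢0 = grundy-unique oddGrundy reach avoid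
    where
    value : ∀ m {a W} → a ∈ L → W ∈ L → ⟦ a ⟧ ⊑ ⟦ W ⟧ → m + Dim a ≡ Dim W →
            intervalSum (oddGrundy ∘ Dim) a W ≡ oddGrundy (m + Dim W)
    value m a∈ W∈ a⊑W eq = intervalSum-odd 2≢0 m a∈ W∈ a⊑W eq oddGrundy oddGrundy-fib
    reach : ∀ {W j} → W ∈ L → j < oddGrundy (Dim W) →
      ∃ λ a → a ∈ L × ⟦ a ⟧ ⊑ ⟦ W ⟧ × oddGrundy (Dim W) ⊕ intervalSum (oddGrundy ∘ Dim) a W ≡ j
    reach {W} W∈ lt with oddGrundy-options (Dim W) lt
    ... | m , m≤d , eq with subspace-of-dim W∈ (Dim W ∸ m) (m∸n≤m (Dim W) m)
    ... | a , a∈ , a⊑W , Da = a , a∈ , a⊑W , trans (cong (oddGrundy (Dim W) ⊕_)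
            (value m a∈ W∈ a⊑W (trans (cong (m +_) Da) (m+[n∸m]≡n m≤d)))) eq
    avoid : ∀ {a W} → a ∈ L → W ∈ L → ⟦ a ⟧ ⊑ ⟦ W ⟧ →
      oddGrundy (Dim W) ⊕ intervalSum (oddGrundy ∘ Dim) a W ≢ oddGrundy (Dim W)
    -- Equality would force the interval sum to be zero, yet it is again a value of `oddGrundy`,
    -- which is positive because of the `+ 1`.
    avoid {a} {W} a∈ W∈ a⊑W eq = 0≢1+n (begin
      0                                         ≡⟨ ⊕-self G ⟨
      G ⊕ G                                     ≡⟨ cong (G ⊕_) eq ⟨
      G ⊕ (G ⊕ intervalSum (oddGrundy ∘ Dim) a W) ≡⟨ ⊕-cancelˡ G _ ⟩
      intervalSum (oddGrundy ∘ Dim) a W         ≡⟨ value m a∈ W∈ a⊑W (codim a⊑W) ⟩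
      (m + Dim W) % 3 + 1                       ≡⟨ +-comm _ 1 ⟩
      suc ((m + Dim W) % 3)                     ∎)
      where
      open ≡-Reasoning
      G = oddGrundy (Dim W)
      m = Dim W ∸ Dim a

module _ (F : FiniteField) where

  open LinearAlgebra F using (1#; 0#; _+F_; _≟F_; dim-full)
  open Characteristic F
  open SubspaceLattice F using (fullSpace-∈; fullSpace-∋; HasDim⇒dim)

  gq-even : 1# +F 1# ≡ 0# → ∀ d → gq F d ≡ evenGrundy d
  gq-even 2≡0 d = trans (Grundy.grundy-even F d 2≡0 (fullSpace-∈ d)) (cong evenGrundy (dim-full (fullSpace-∋ d)))

  gq-odd : 1# +F 1# ≢ 0# → ∀ d → gq F d ≡ oddGrundy d
  gq-odd 2≢0 d = trans (Grundy.grundy-odd F d 2≢0 (fullSpace-∈ d)) (cong oddGrundy (dim-full (fullSpace-∋ d)))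

  -- The interval below `W` is not transported to the lattice of a smaller space: both sides are
  -- evaluated, and they are the same function of the dimension.
  grundyB≡gq : ∀ n W d → W ∈ subspaces F n → HasDim F n W d → grundyB F n W ≡ gq F d
  grundyB≡gq n W d W∈ h with 1# +F 1# ≟F 0#
  ... | yes 2≡0 = trans (Grundy.grundy-even F n 2≡0 W∈)
                    (trans (cong evenGrundy (HasDim⇒dim n W∈ h)) (sym (gq-even 2≡0 d)))
  ... | no  2≢0 = trans (Grundy.grundy-odd F n 2≢0 W∈)
                    (trans (cong oddGrundy (HasDim⇒dim n W∈ h)) (sym (gq-odd 2≢0 d)))

mainTheorem3 : (F : FiniteField) →
    ((n : ℕ) (W : List Bool) (d : ℕ) → W ∈ subspaces F n → HasDim F n W d →
    grundyB F n W ≡ gq F d)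
    × (2 ∣ FiniteField.size F → (d : ℕ) →
    Σ ℕ (λ k → gq F d ≡ 2 ^ k × 2 ^ k ∣ suc d × ¬ (2 ^ suc k ∣ suc d)))
    × (¬ (2 ∣ FiniteField.size F) → (d : ℕ) → gq F d ≡ (d % 3) + 1)
mainTheorem3 F = grundyB≡gq F ,
  (λ 2∣size d → let k , eq , dvd , ndvd = gray-suc d in
     k , trans (gq-even F (even⇒2≡0 2∣size) d) eq , dvd , ndvd) ,
  (λ ¬2∣size d → gq-odd F (odd⇒2≢0 ¬2∣size) d)
  where open Characteristic F
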